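{- There exists a Jordan-measurable coloring of the plane $\mathbb{R}^2$ in $25$ colors such that no color-class contains the (four) vertices of a rectangle of area $1$.
   Context: A coloring of $\mathbb{R}^2$ in $r$ colors is a partition of $\mathbb{R}^2$ into $r$ sets, called color-classes. It is Jordan-measurable if the boundary of every color-class has Lebesgue measure $0$. Rectangles may be arbitrarily rotated (they need not be axes-aligned). -}

module Defs where

open import Data.Fin.Base using (Fin)
open import Data.Fin.Patterns using (0F; 1F; 2F; 3F)
open import Data.Nat.Base as ℕ using (ℕ; zero; suc; _⊔_)
import Data.Nat.Properties as ℕₚ
open import Data.Product.Base using (_×_; _,_; proj₁; proj₂; ∃-syntax; Σ-syntax)
open import Data.Rational.Base as ℚ using (ℚ; 0ℚ; 1ℚ; ½; ∣_∣)
import Data.Rational.Properties as ℚₚ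
open import Level using (0ℓ)
open import Relation.Binary.Definitions using (_Respects_)
open import Relation.Binary.PropositionalEquality
  using (_≡_; _≢_; sym; trans; cong; subst)
open import Relation.Nullary.Decidable.Core using (dec⇒maybe)
open import Relation.Nullary.Negation.Core using (¬_)
open import Relation.Unary using (Pred; _∈_; _⊆_; _⊥_; ⋃; Satisfiable; Universal)
open import Tactic.RingSolver using (solve-∀)
open import Tactic.RingSolver.Core.AlmostCommutativeRing
  using (AlmostCommutativeRing; fromCommutativeRing)

------------------------------------------------------------------------
-- Real numbers: Cauchy sequences of rationals, with equality _≈_ in
-- place of the quotient by null sequences.

IsCauchy : (ℕ → ℚ) → Set
IsCauchy s = ∀ ε → 0ℚ ℚ.< ε →
  ∃[ N ] (∀ m n → N ℕ.≤ m → N ℕ.≤ n → ∣ s m ℚ.- s n ∣ ℚ.< ε)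

record ℝ : Set where
  constructor mkℝ
  field
    seq    : ℕ → ℚ
    cauchy : IsCauchy seq

open ℝ public

infix 4 _≈_ _<_ _≤_

_≈_ : ℝ → ℝ → Set
x ≈ y = ∀ ε → 0ℚ ℚ.< ε → ∃[ N ] (∀ n → N ℕ.≤ n → ∣ seq x n ℚ.- seq y n ∣ ℚ.< ε)

_<_ : ℝ → ℝ → Set
x < y = ∃[ ε ] (0ℚ ℚ.< ε × ∃[ N ] (∀ n → N ℕ.≤ n → seq x n ℚ.+ ε ℚ.≤ seq y n))

_≤_ : ℝ → ℝ → Set
x ≤ y = ¬ (y < x)

private

  ℚ-ring : AlmostCommutativeRing 0ℓ 0ℓ
  ℚ-ring = fromCommutativeRing ℚₚ.+-*-commutativeRing (λ p → dec⇒maybe (0ℚ ℚₚ.≟ p))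

  halve : ∀ ε → 0ℚ ℚ.< ε → 0ℚ ℚ.< ½ ℚ.* ε
  halve ε 0<ε =
    subst (ℚ._< ½ ℚ.* ε) (ℚₚ.*-zeroʳ ½) (ℚₚ.*-monoʳ-<-pos ½ 0<ε)

  halves : ∀ ε → ½ ℚ.* ε ℚ.+ ½ ℚ.* ε ≡ ε
  halves ε = trans (sym (ℚₚ.*-distribʳ-+ ε ½ ½)) (ℚₚ.*-identityˡ ε)

  const-cauchy : ∀ q → IsCauchy (λ _ → q)
  const-cauchy q ε 0<ε = 0 , λ _ _ _ _ →
    subst (λ d → ∣ d ∣ ℚ.< ε) (sym (ℚₚ.+-inverseʳ q)) 0<ε

  +-cauchy : ∀ {s t} → IsCauchy s → IsCauchy t → IsCauchy (λ n → s n ℚ.+ t n)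
  +-cauchy {s} {t} cs ct ε 0<ε
    with M , hs ← cs (½ ℚ.* ε) (halve ε 0<ε)
       | N , ht ← ct (½ ℚ.* ε) (halve ε 0<ε)
    = M ⊔ N , λ m n m≥ n≥ → begin-strict
        ∣ (s m ℚ.+ t m) ℚ.- (s n ℚ.+ t n) ∣
          ≡⟨ cong ∣_∣ (rearrange (s m) (t m) (s n) (t n)) ⟩
        ∣ (s m ℚ.- s n) ℚ.+ (t m ℚ.- t n) ∣
          ≤⟨ ℚₚ.∣p+q∣≤∣p∣+∣q∣ (s m ℚ.- s n) (t m ℚ.- t n) ⟩
        ∣ s m ℚ.- s n ∣ ℚ.+ ∣ t m ℚ.- t n ∣
          <⟨ ℚₚ.+-mono-< (hs m n (ℕₚ.m⊔n≤o⇒m≤o M N m≥) (ℕₚ.m⊔n≤o⇒m≤o M N n≥))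
                         (ht m n (ℕₚ.m⊔n≤o⇒n≤o M N m≥) (ℕₚ.m⊔n≤o⇒n≤o M N n≥)) ⟩
        ½ ℚ.* ε ℚ.+ ½ ℚ.* ε
          ≡⟨ halves ε ⟩
        ε ∎
    where
    open ℚₚ.≤-Reasoning
    rearrange : ∀ a b c d →
      (a ℚ.+ b) ℚ.- (c ℚ.+ d) ≡ (a ℚ.- c) ℚ.+ (b ℚ.- d)
    rearrange = solve-∀ ℚ-ring

  neg-cauchy : ∀ {s} → IsCauchy s → IsCauchy (λ n → ℚ.- s n)
  neg-cauchy {s} cs ε 0<ε with N , h ← cs ε 0<ε = N , λ m n m≥ n≥ →
    subst (ℚ._< ε)
      (trans (sym (ℚₚ.∣-p∣≡∣p∣ (s m ℚ.- s n)))
             (cong ∣_∣ (ℚₚ.neg-distrib-+ (s m) (ℚ.- s n))))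
      (h m n m≥ n≥)

  eventually-bounded : ∀ {s} → IsCauchy s →
    ∃[ B ] (0ℚ ℚ.< B × ∃[ N ] (∀ n → N ℕ.≤ n → ∣ s n ∣ ℚ.≤ B))
  eventually-bounded {s} cs with N , h ← cs 1ℚ (ℚₚ.positive⁻¹ 1ℚ) =
    1ℚ ℚ.+ ∣ s N ∣ ,
    ℚₚ.+-mono-<-≤ (ℚₚ.positive⁻¹ 1ℚ) (ℚₚ.0≤∣p∣ (s N)) ,
    N , λ n n≥ → begin
      ∣ s n ∣
        ≡⟨ cong ∣_∣ (split (s n) (s N)) ⟩
      ∣ (s n ℚ.- s N) ℚ.+ s N ∣
        ≤⟨ ℚₚ.∣p+q∣≤∣p∣+∣q∣ (s n ℚ.- s N) (s N) ⟩
      ∣ s n ℚ.- s N ∣ ℚ.+ ∣ s N ∣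
        ≤⟨ ℚₚ.+-monoˡ-≤ ∣ s N ∣ (ℚₚ.<⇒≤ (h n N n≥ ℕₚ.≤-refl)) ⟩
      1ℚ ℚ.+ ∣ s N ∣ ∎
    where
    open ℚₚ.≤-Reasoning
    split : ∀ a b → a ≡ (a ℚ.- b) ℚ.+ b
    split = solve-∀ ℚ-ring

  divide : ∀ B ε → 0ℚ ℚ.< B → 0ℚ ℚ.< ε → ∃[ δ ] (0ℚ ℚ.< δ × B ℚ.* δ ≡ ε)
  divide B ε 0<B 0<ε = 1/B ℚ.* ε , 0<δ ,
    trans (sym (ℚₚ.*-assoc B 1/B ε))
          (trans (cong (ℚ._* ε) (ℚₚ.*-inverseʳ B)) (ℚₚ.*-identityˡ ε))
    where
    instance
      B-pos : ℚ.Positive B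
      B-pos = ℚ.positive 0<B
      B-nonZero : ℚ.NonZero B
      B-nonZero = ℚₚ.pos⇒nonZero B
    1/B : ℚ
    1/B = ℚ.1/ B
    instance
      1/B-pos : ℚ.Positive 1/B
      1/B-pos = ℚₚ.1/pos⇒pos B
    0<δ : 0ℚ ℚ.< 1/B ℚ.* ε
    0<δ = subst (ℚ._< 1/B ℚ.* ε) (ℚₚ.*-zeroʳ 1/B) (ℚₚ.*-monoʳ-<-pos 1/B 0<ε)

  *-bound : ∀ {B δ} a d → 0ℚ ℚ.< B → ∣ a ∣ ℚ.≤ B → ∣ d ∣ ℚ.< δ → ∣ a ℚ.* d ∣ ℚ.< B ℚ.* δ
  *-bound {B} {δ} a d 0<B a≤B d<δ = begin-strict
    ∣ a ℚ.* d ∣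
      ≡⟨ ℚₚ.∣p*q∣≡∣p∣*∣q∣ a d ⟩
    ∣ a ∣ ℚ.* ∣ d ∣
      ≤⟨ ℚₚ.*-monoʳ-≤-nonNeg ∣ d ∣ {{ℚₚ.∣-∣-nonNeg d}} a≤B ⟩
    B ℚ.* ∣ d ∣
      <⟨ ℚₚ.*-monoʳ-<-pos B {{ℚ.positive 0<B}} d<δ ⟩
    B ℚ.* δ ∎
    where open ℚₚ.≤-Reasoning

  *-close : ∀ {A B δ ε} a b c d →
    0ℚ ℚ.< A → 0ℚ ℚ.< B → (A ℚ.+ B) ℚ.* δ ≡ ε →
    ∣ a ∣ ℚ.≤ A → ∣ d ∣ ℚ.≤ B → ∣ a ℚ.- c ∣ ℚ.< δ → ∣ b ℚ.- d ∣ ℚ.< δ →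
    ∣ a ℚ.* b ℚ.- c ℚ.* d ∣ ℚ.< ε
  *-close {A} {B} {δ} {ε} a b c d 0<A 0<B eq a≤A d≤B ac<δ bd<δ = begin-strict
    ∣ a ℚ.* b ℚ.- c ℚ.* d ∣
      ≡⟨ cong ∣_∣ (rearrange a b c d) ⟩
    ∣ a ℚ.* (b ℚ.- d) ℚ.+ d ℚ.* (a ℚ.- c) ∣
      ≤⟨ ℚₚ.∣p+q∣≤∣p∣+∣q∣ (a ℚ.* (b ℚ.- d)) (d ℚ.* (a ℚ.- c)) ⟩
    ∣ a ℚ.* (b ℚ.- d) ∣ ℚ.+ ∣ d ℚ.* (a ℚ.- c) ∣
      <⟨ ℚₚ.+-mono-< (*-bound a (b ℚ.- d) 0<A a≤A bd<δ)
                     (*-bound d (a ℚ.- c) 0<B d≤B ac<δ) ⟩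
    A ℚ.* δ ℚ.+ B ℚ.* δ
      ≡⟨ ℚₚ.*-distribʳ-+ δ A B ⟨
    (A ℚ.+ B) ℚ.* δ
      ≡⟨ eq ⟩
    ε ∎
    where
    open ℚₚ.≤-Reasoning
    rearrange : ∀ a b c d →
      a ℚ.* b ℚ.- c ℚ.* d ≡ a ℚ.* (b ℚ.- d) ℚ.+ d ℚ.* (a ℚ.- c)
    rearrange = solve-∀ ℚ-ring

  *-cauchy : ∀ {s t} → IsCauchy s → IsCauchy t → IsCauchy (λ n → s n ℚ.* t n)
  *-cauchy {s} {t} cs ct ε 0<ε =
    let A , 0<A , K , hA = eventually-bounded cs
        B , 0<B , L , hB = eventually-bounded ct
        δ , 0<δ , eq     = divide (A ℚ.+ B) ε (ℚₚ.+-mono-< 0<A 0<B) 0<ε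
        M , hs           = cs δ 0<δ
        N , ht           = ct δ 0<δ
    in (K ⊔ L) ⊔ (M ⊔ N) , λ m n m≥ n≥ →
      let m≥KL = ℕₚ.m⊔n≤o⇒m≤o (K ⊔ L) (M ⊔ N) m≥
          n≥KL = ℕₚ.m⊔n≤o⇒m≤o (K ⊔ L) (M ⊔ N) n≥
          m≥MN = ℕₚ.m⊔n≤o⇒n≤o (K ⊔ L) (M ⊔ N) m≥
          n≥MN = ℕₚ.m⊔n≤o⇒n≤o (K ⊔ L) (M ⊔ N) n≥
      in *-close {A} {B} {δ} {ε} (s m) (t m) (s n) (t n) 0<A 0<B eq
           (hA m (ℕₚ.m⊔n≤o⇒m≤o K L m≥KL))
           (hB n (ℕₚ.m⊔n≤o⇒n≤o K L n≥KL))
           (hs m n (ℕₚ.m⊔n≤o⇒m≤o M N m≥MN) (ℕₚ.m⊔n≤o⇒m≤o M N n≥MN))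
           (ht m n (ℕₚ.m⊔n≤o⇒n≤o M N m≥MN) (ℕₚ.m⊔n≤o⇒n≤o M N n≥MN))

infix  8 -_
infixl 7 _*_
infixl 6 _+_ _-_

fromℚ : ℚ → ℝ
fromℚ q = mkℝ (λ _ → q) (const-cauchy q)

0ℝ 1ℝ : ℝ
0ℝ = fromℚ 0ℚ
1ℝ = fromℚ 1ℚ

_+_ : ℝ → ℝ → ℝ
x + y = mkℝ (λ n → seq x n ℚ.+ seq y n) (+-cauchy {seq x} {seq y} (cauchy x) (cauchy y))

-_ : ℝ → ℝ
- x = mkℝ (λ n → ℚ.- seq x n) (neg-cauchy {seq x} (cauchy x))

_-_ : ℝ → ℝ → ℝ
x - y = x + (- y)

_*_ : ℝ → ℝ → ℝ
x * y = mkℝ (λ n → seq x n ℚ.* seq y n) (*-cauchy {seq x} {seq y} (cauchy x) (cauchy y))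

------------------------------------------------------------------------
-- The Euclidean plane

ℝ² : Set
ℝ² = ℝ × ℝ

infix 4 _≈²_

_≈²_ : ℝ² → ℝ² → Set
(x , y) ≈² (x′ , y′) = x ≈ x′ × y ≈ y′

dist² : ℝ² → ℝ² → ℝ
dist² (x , y) (x′ , y′) = (x - x′) * (x - x′) + (y - y′) * (y - y′)

Ball : ℝ² → ℝ → Pred ℝ² 0ℓ
Ball p r q = dist² p q < r * r

Interior : Pred ℝ² 0ℓ → Pred ℝ² 0ℓ
Interior A p = ∃[ r ] (0ℝ < r × Ball p r ⊆ A)

Closure : Pred ℝ² 0ℓ → Pred ℝ² 0ℓ
Closure A p = ∀ r → 0ℝ < r → ∃[ q ] (q ∈ Ball p r × q ∈ A)

Boundary : Pred ℝ² 0ℓ → Pred ℝ² 0ℓ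
Boundary A p = p ∈ Closure A × ¬ (p ∈ Interior A)

------------------------------------------------------------------------
-- Lebesgue null sets

record Box : Set where
  field
    left right bottom top : ℝ
    left≤right : left ≤ right
    bottom≤top : bottom ≤ top

  ⟦_⟧ : Pred ℝ² 0ℓ
  ⟦_⟧ (x , y) = (left ≤ x × x ≤ right) × (bottom ≤ y × y ≤ top)

  boxArea : ℝ
  boxArea = (right - left) * (top - bottom)

open Box public using (⟦_⟧; boxArea)

partialSum : (ℕ → ℝ) → ℕ → ℝ
partialSum f zero    = 0ℝ
partialSum f (suc n) = partialSum f n + f n

-- The outer measure of A is 0: the infimum, over countable covers of A
-- by boxes, of the total area is 0.  As areas are nonnegative, the total
-- area is at most ε iff all partial sums are.
LebesgueNull : Pred ℝ² 0ℓ → Set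
LebesgueNull A = ∀ ε → 0ℝ < ε →
  Σ[ B ∈ (ℕ → Box) ]
    (A ⊆ ⋃ ℕ (λ n → ⟦ B n ⟧) × ∀ n → partialSum (λ k → boxArea (B k)) n ≤ ε)

------------------------------------------------------------------------
-- Colorings

record Coloring (r : ℕ) : Set₁ where
  field
    colorClass : Fin r → Pred ℝ² 0ℓ
    respects   : ∀ i → colorClass i Respects _≈²_
    nonempty   : ∀ i → Satisfiable (colorClass i)
    disjoint   : ∀ {i j} → i ≢ j → colorClass i ⊥ colorClass j
    covers     : Universal (⋃ (Fin r) colorClass)

open Coloring public using (colorClass)

JordanMeasurable : ∀ {r} → Coloring r → Set
JordanMeasurable c = ∀ i → LebesgueNull (Boundary (colorClass c i))

------------------------------------------------------------------------
-- Rectangles in arbitrary position: the image of [0,width] × [0,height]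
-- under the rotation taking (1 , 0) to the unit vector (u , v), followed
-- by the translation taking the origin to the corner.

record Rectangle : Set where
  field
    corner       : ℝ²
    u v          : ℝ
    unit         : u * u + v * v ≈ 1ℝ
    width height : ℝ
    0<width      : 0ℝ < width
    0<height     : 0ℝ < height

  private
    place : ℝ → ℝ → ℝ²
    place s t = proj₁ corner + (s * u - t * v) , proj₂ corner + (s * v + t * u)

  vertex : Fin 4 → ℝ²
  vertex 0F = place 0ℝ 0ℝ
  vertex 1F = place width 0ℝ
  vertex 2F = place width height
  vertex 3F = place 0ℝ height

  area : ℝ
  area = width * height

open Rectangle public using (vertex; area)

ContainsVertices : Pred ℝ² 0ℓ → Rectangle → Set
ContainsVertices A R = ∀ k → vertex R k ∈ A

{-# OPTIONS --safe #-}
module Submission where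

-- Color z by the cell containing z² in the grid of half-open squares of side
-- s = 7/10, the indices of the cell being taken modulo 5.  If the sides of a
-- rectangle are the complex numbers a and b, the alternating sum W of z² over
-- its vertices is 2 a b, so ∣ W ∣ = 2 for area 1.  For monochromatic vertices
-- each coordinate of W is within 2 s of a multiple of 5 s.  If both multiples
-- are 0 then ∣ W ∣² ≤ 2 (2 s)² < 4; otherwise ∣ W ∣ ≥ 3 s > 2.
--
-- The boundary of a color class lies on the hyperbolas x² − y² = k s and
-- 2 x y = k s.  Away from the axes these are, piecewise, graphs of Lipschitz
-- functions of y, and a Lipschitz graph over an interval cut into n strips is
-- covered by n boxes of area O(1 / n²).

open import Defs hiding (_+_; _-_; _*_; -_; _<_; _≤_)
import Defs as R

open import Axiom.ExcludedMiddle using (ExcludedMiddle)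
open import Data.Empty using (⊥)
open import Data.Fin.Base using (Fin; combine; fromℕ<; toℕ)
open import Data.Fin.Patterns using (0F; 1F; 2F; 3F)
import Data.Fin.Properties as Finₚ
open import Data.Integer.Base as ℤ using (ℤ; +_; -[1+_]; +[1+_])
import Data.Integer.DivMod as ℤ
import Data.Integer.Properties as ℤₚ
open import Data.List.Base using (List; []; _∷_; _++_; map; upTo; lookup)
open import Data.List.Membership.Propositional using (lose) renaming (_∈_ to _∈ˡ_)
open import Data.List.Membership.Propositional.Properties
  using (∈-++⁺ˡ; ∈-++⁺ʳ; ∈-map⁺; ∈-upTo⁺)
open import Data.List.Relation.Unary.Any using (Any; here; there)
open import Data.List.Relation.Unary.Any.Properties using (++⁺ˡ; ++⁺ʳ)
open import Data.Nat.Base as ℕ using (ℕ; zero; suc)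
import Data.Nat.Coprimality as Coprime
import Data.Nat.Properties as ℕₚ
open import Data.Product.Base using (_×_; _,_; proj₁; proj₂; ∃-syntax; Σ-syntax)
open import Data.Rational.Base
  using (ℚ; mkℚ; 0ℚ; 1ℚ; ½; _+_; _-_; _*_; -_; _<_; _≤_; *≤*; _/_; 1/_; ∣_∣; floor;
         positive; nonNegative)
import Data.Rational.Properties as ℚₚ
open import Data.Sum.Base using (_⊎_; inj₁; inj₂)
open import Level using (0ℓ)
open import Relation.Binary.Definitions using (_Respects_; tri<; tri≈; tri>)
open import Relation.Binary.PropositionalEquality
  using (_≡_; refl; sym; trans; cong; cong₂; subst; subst₂)
open import Relation.Nullary.Decidable using (Dec; yes; no; dec⇒maybe; from-yes; _×-dec_)
open import Relation.Nullary.Negation.Core using (¬_; contradiction)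
open import Relation.Unary using (Pred; _∈_; _⊆_; _∪_; ⋃; Satisfiable)
open import Tactic.RingSolver using (solve)
open import Tactic.RingSolver.Core.AlmostCommutativeRing
  using (AlmostCommutativeRing; fromCommutativeRing)

-- Rational arithmetic

-- With indices taken modulo m, the two cases ask for 8 s² ≤ 4 and (m - 2) s ≥ 2. Together they
-- force m - 2 ≥ 2 √2, so 5 is the least modulus that works, and it admits every s from 2/3 to 1/√2.
-- The value 7/10 is a rational strictly inside this range: 8 s² = 3.92 and 3 s = 2.1. This slack is
-- what makes Cauchy sequences harmless. Ring operations act termwise, so area 1, the unit direction
-- and the cells of the vertices turn into rational estimates with small errors, all valid at one
-- common index, and the final contradiction is between rationals. For the boundary, the obstacle is
-- that no Lipschitz constant serves all the curves at once: slopes blow up near the axes and at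
-- infinity. Hence the curves are cut into countably many bounded pieces that keep away from an
-- axis. Excluded middle serves to compare reals with rationals and to decide whether a strip is
-- empty.

ℚ-ring : AlmostCommutativeRing 0ℓ 0ℓ
ℚ-ring = fromCommutativeRing ℚₚ.+-*-commutativeRing (λ p → dec⇒maybe (0ℚ ℚₚ.≟ p))

-- The ring solver proves b ≡ a + c, where c is built from nonnegative terms by
-- gap, _⊕_ and _⊗_.

≤-by : ∀ {a b c} → 0ℚ ≤ c → b ≡ a + c → a ≤ b
≤-by {a} {c = c} 0≤c refl = subst (_≤ a + c) (ℚₚ.+-identityʳ a) (ℚₚ.+-monoʳ-≤ a 0≤c)

<-by : ∀ {a b c} → 0ℚ < c → b ≡ a + c → a < b
<-by {a} {c = c} 0<c refl = subst (_< a + c) (ℚₚ.+-identityʳ a) (ℚₚ.+-monoʳ-< a 0<c)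

gap : ∀ {a b} → a ≤ b → 0ℚ ≤ b - a
gap {a} {b} a≤b = subst (_≤ b - a) (ℚₚ.+-inverseʳ a) (ℚₚ.+-monoˡ-≤ (- a) a≤b)

gap< : ∀ {a b} → a < b → 0ℚ < b - a
gap< {a} {b} a<b = subst (_< b - a) (ℚₚ.+-inverseʳ a) (ℚₚ.+-monoˡ-< (- a) a<b)

infixl 6 _⊕_ _⊕<_
infixl 7 _⊗_ _⊗<_

_⊕_ : ∀ {a b} → 0ℚ ≤ a → 0ℚ ≤ b → 0ℚ ≤ a + b
0≤a ⊕ 0≤b = ℚₚ.+-mono-≤ 0≤a 0≤b

_⊕<_ : ∀ {a b} → 0ℚ ≤ a → 0ℚ < b → 0ℚ < a + b
0≤a ⊕< 0<b = ℚₚ.+-mono-≤-< 0≤a 0<b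

_⊗_ : ∀ {a b} → 0ℚ ≤ a → 0ℚ ≤ b → 0ℚ ≤ a * b
_⊗_ {a} {b} 0≤a 0≤b = subst (_≤ a * b) (ℚₚ.*-zeroʳ a)
  (ℚₚ.*-monoˡ-≤-nonNeg a {{nonNegative 0≤a}} 0≤b)

_⊗<_ : ∀ {a b} → 0ℚ < a → 0ℚ < b → 0ℚ < a * b
_⊗<_ {a} {b} 0<a 0<b = subst (_< a * b) (ℚₚ.*-zeroʳ a)
  (ℚₚ.*-monoʳ-<-pos a {{positive 0<a}} 0<b)

0≤½ : 0ℚ ≤ ½
0≤½ = ℚₚ.nonNegative⁻¹ ½

0<½ : 0ℚ < ½
0<½ = ℚₚ.positive⁻¹ ½

0≤1 : 0ℚ ≤ 1ℚ
0≤1 = ℚₚ.nonNegative⁻¹ 1ℚ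

0<1 : 0ℚ < 1ℚ
0<1 = ℚₚ.positive⁻¹ 1ℚ

min : ∀ {a b} → 0ℚ < a → 0ℚ < b → ∃[ m ] (0ℚ < m × m ≤ a × m ≤ b)
min {a} {b} 0<a 0<b with ℚₚ.≤-total a b
... | inj₁ a≤b = a , 0<a , ℚₚ.≤-refl , a≤b
... | inj₂ b≤a = b , 0<b , b≤a , ℚₚ.≤-refl

-- Stands for ∣ a ∣ ≤ A, which the ring solver could not handle.
Bd : ℚ → ℚ → Set
Bd a A = - A ≤ a × a ≤ A

Bd-mono : ∀ {a A B} → A ≤ B → Bd a A → Bd a B
Bd-mono A≤B (l , u) = ℚₚ.≤-trans (ℚₚ.neg-antimono-≤ A≤B) l , ℚₚ.≤-trans u A≤B

Bd-sym : ∀ {a b A} → Bd (a - b) A → Bd (b - a) A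
Bd-sym {a} {b} {A} (l , u) =
  ≤-by (gap u) (solve (a ∷ b ∷ A ∷ []) ℚ-ring) ,
  ≤-by (gap l) (solve (a ∷ b ∷ A ∷ []) ℚ-ring)

Bd-+ : ∀ {a b A B} → Bd a A → Bd b B → Bd (a + b) (A + B)
Bd-+ {a} {b} {A} {B} (l , u) (l′ , u′) =
  ≤-by (gap l ⊕ gap l′) (solve (a ∷ b ∷ A ∷ B ∷ []) ℚ-ring) ,
  ≤-by (gap u ⊕ gap u′) (solve (a ∷ b ∷ A ∷ B ∷ []) ℚ-ring)

-- Both `A * B + a * b` and `A * B - a * b` are half-sums of products of the nonnegative gaps A ± a
-- and B ± b, which replaces a case split on signs.
Bd-* : ∀ {a b A B} → Bd a A → Bd b B → Bd (a * b) (A * B)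
Bd-* {a} {b} {A} {B} (l , u) (l′ , u′) =
  ≤-by (0≤½ ⊗ (gap u ⊗ gap u′ ⊕ gap l ⊗ gap l′)) (solve (a ∷ b ∷ A ∷ B ∷ []) ℚ-ring) ,
  ≤-by (0≤½ ⊗ (gap u ⊗ gap l′ ⊕ gap l ⊗ gap u′)) (solve (a ∷ b ∷ A ∷ B ∷ []) ℚ-ring)

∣∣≤⇒Bd : ∀ {a A} → ∣ a ∣ ≤ A → Bd a A
∣∣≤⇒Bd {a} {A} h with ℚₚ.∣p∣≡p∨∣p∣≡-p a
... | inj₁ eq = ≤-by (gap h ⊕ (0≤∣a∣ ⊕ 0≤∣a∣)) (rearrange eq) , subst (_≤ A) eq h
  where
  0≤∣a∣ = ℚₚ.0≤∣p∣ a
  rearrange : ∀ {b} → b ≡ a → a ≡ - A + ((A - b) + (b + b))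
  rearrange refl = solve (a ∷ A ∷ []) ℚ-ring
... | inj₂ eq = ≤-by (gap h) (rearrange eq) , ≤-by
    (gap h ⊕ (0≤∣a∣ ⊕ 0≤∣a∣)) (rearrange′ eq)
  where
  0≤∣a∣ = ℚₚ.0≤∣p∣ a
  rearrange : ∀ {b} → b ≡ - a → a ≡ - A + (A - b)
  rearrange refl = solve (a ∷ A ∷ []) ℚ-ring
  rearrange′ : ∀ {b} → b ≡ - a → A ≡ a + ((A - b) + (b + b))
  rearrange′ refl = solve (a ∷ A ∷ []) ℚ-ring

Bd-∣∣ : ∀ a → Bd a ∣ a ∣
Bd-∣∣ a = ∣∣≤⇒Bd ℚₚ.≤-refl

-² : ∀ a → a * a ≡ - a * - a
-² a = solve (a ∷ []) ℚ-ring

sq≤⇒≤ : ∀ {u d} → 0ℚ < d → u * u ≤ d * d → u ≤ d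
sq≤⇒≤ {u} {d} 0<d h = ℚₚ.≮⇒≥ λ d<u → ℚₚ.<-irrefl refl (ℚₚ.<-≤-trans (d²<u² d<u) h)
  where
  d²<u² : d < u → d * d < u * u
  d²<u² d<u = <-by (gap (ℚₚ.<⇒≤ d<u) ⊗ gap (ℚₚ.<⇒≤ d<u) ⊕< (0<d ⊕<′ 0<d) ⊗< gap< d<u)
                (solve (u ∷ d ∷ []) ℚ-ring)
    where
    _⊕<′_ : ∀ {a b} → 0ℚ < a → 0ℚ < b → 0ℚ < a + b
    p ⊕<′ q = ℚₚ.<⇒≤ p ⊕< q

sq≤⇒Bd : ∀ {u d} → 0ℚ < d → u * u ≤ d * d → Bd u d
sq≤⇒Bd {u} {d} 0<d h =
  ≤-by (gap -u≤d) (solve (u ∷ d ∷ []) ℚ-ring) , sq≤⇒≤ 0<d h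
  where
  -u≤d : - u ≤ d
  -u≤d = sq≤⇒≤ 0<d (subst (_≤ d * d) (-² u) h)

0≤sq : ∀ a → 0ℚ ≤ a * a
0≤sq a with ℚₚ.≤-total 0ℚ a
... | inj₁ 0≤a = 0≤a ⊗ 0≤a
... | inj₂ a≤0 = ≤-by (gap a≤0 ⊗ gap a≤0) (solve (a ∷ []) ℚ-ring)

-- Integers among the rationals, the Archimedean property, powers of one half

-- Opaque because unfolding the arithmetic of ι k for a variable k makes
-- conversion checking very slow.
opaque

  ι : ℤ → ℚ
  ι k = mkℚ k 0 (Coprime.sym (Coprime.1-coprimeTo ℤ.∣ k ∣))

  ι≡/1 : ∀ k → ι k ≡ k / 1
  ι≡/1 k = sym (ℚₚ.↥p/↧p≡p (ι k))

  ι0 : ι (+ 0) ≡ 0ℚ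
  ι0 = refl

  ι1 : ι (+ 1) ≡ 1ℚ
  ι1 = refl

  ι-+ : ∀ i j → ι (i ℤ.+ j) ≡ ι i + ι j
  ι-+ i j = trans (sym (ℚₚ.↥p/↧p≡p (ι (i ℤ.+ j))))
    (cong (_/ 1) (sym (cong₂ ℤ._+_ (ℤₚ.*-identityʳ i) (ℤₚ.*-identityʳ j))))

  ι-* : ∀ i j → ι (i ℤ.* j) ≡ ι i * ι j
  ι-* i j = sym (ℚₚ.↥p/↧p≡p (ι (i ℤ.* j)))

  ι-neg : ∀ i → ι (ℤ.- i) ≡ - ι i
  ι-neg (+ zero)  = refl
  ι-neg +[1+ _ ]  = refl
  ι-neg -[1+ _ ]  = refl

  ι-mono : ∀ {i j} → i ℤ.≤ j → ι i ≤ ι j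
  ι-mono i≤j = *≤* (subst₂ ℤ._≤_ (sym (ℤₚ.*-identityʳ _)) (sym (ℤₚ.*-identityʳ _)) i≤j)

  ≤ι : ∀ q → ∃[ n ] q ≤ ι (+ n)
  ≤ι q@(mkℚ k d _) = ℤ.∣ k ∣ , *≤* (begin
    k ℤ.* + 1              ≡⟨ ℤₚ.*-identityʳ k ⟩
    k                      ≤⟨ i≤∣i∣ k ⟩
    + ℤ.∣ k ∣              ≤⟨ ℤ.+≤+ (ℕₚ.m≤m*n ℤ.∣ k ∣ (suc d)) ⟩
    + (ℤ.∣ k ∣ ℕ.* suc d)  ≡⟨ ℤₚ.pos-* ℤ.∣ k ∣ (suc d) ⟩
    + ℤ.∣ k ∣ ℤ.* + suc d  ∎)
    where
    open ℤₚ.≤-Reasoning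
    i≤∣i∣ : ∀ i → i ℤ.≤ + ℤ.∣ i ∣
    i≤∣i∣ (+ n)    = ℤₚ.≤-refl
    i≤∣i∣ -[1+ n ] = ℤ.-≤+

ν : ℕ → ℚ
ν n = ι (+ n)

ν-suc : ∀ n → ν (suc n) ≡ 1ℚ + ν n
ν-suc n = trans (ι-+ (+ 1) (+ n)) (cong (λ q → q + ν n) ι1)

ν-mono : ∀ {m n} → m ℕ.≤ n → ν m ≤ ν n
ν-mono m≤n = ι-mono (ℤ.+≤+ m≤n)

0≤ν : ∀ n → 0ℚ ≤ ν n
0≤ν n = subst (_≤ ν n) ι0 (ν-mono {0} {n} ℕ.z≤n)

recip : ∀ {ε} → 0ℚ < ε → ∃[ r ] r * ε ≡ 1ℚ
recip {ε} 0<ε = (1/ ε) {{nz}} , ℚₚ.*-inverseˡ ε {{nz}}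
  where nz = ℚₚ.pos⇒nonZero ε {{positive 0<ε}}

≤ν* : ∀ C {ε} → 0ℚ < ε → ∃[ n ] C ≤ ν n * ε
≤ν* C {ε} 0<ε with r , rε≡1 ← recip 0<ε with n , h ← ≤ι (C * r) = n , subst (_≤ ν n * ε)
  (trans (ℚₚ.*-assoc C r ε) (trans (cong (C *_) rε≡1) (ℚₚ.*-identityʳ C)))
  (ℚₚ.*-monoʳ-≤-nonNeg ε {{nonNegative (ℚₚ.<⇒≤ 0<ε)}} h)

½^ : ℕ → ℚ
½^ zero    = 1ℚ
½^ (suc n) = ½ * ½^ n

0<½^ : ∀ n → 0ℚ < ½^ n
0<½^ zero    = 0<1
0<½^ (suc n) = 0<½ ⊗< 0<½^ n

½^≤1 : ∀ n → ½^ n ≤ 1ℚ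
½^≤1 zero    = ℚₚ.≤-refl
½^≤1 (suc n) = ≤-by (0≤½ ⊗ gap (½^≤1 n) ⊕ 0≤½) (rearrange (½^ n))
  where
  rearrange : ∀ p → 1ℚ ≡ ½ * p + (½ * (1ℚ - p) + ½)
  rearrange p = solve (p ∷ []) ℚ-ring

ν*½^≤1 : ∀ n → ν n * ½^ n ≤ 1ℚ
ν*½^≤1 zero    = subst (λ m → m * 1ℚ ≤ 1ℚ) (sym ι0) 0≤1
ν*½^≤1 (suc n) = subst (λ m → m * ½^ (suc n) ≤ 1ℚ) (sym (ν-suc n))
  (≤-by (0≤½ ⊗ gap (ν*½^≤1 n) ⊕ 0≤½ ⊗ gap (½^≤1 n)) (rearrange (ν n) (½^ n)))
  where
  rearrange : ∀ m p → 1ℚ ≡ (1ℚ + m) * (½ * p) + (½ * (1ℚ - m * p) + ½ * (1ℚ - p))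
  rearrange m p = solve (m ∷ p ∷ []) ℚ-ring

-- For n at least C / ε, the bound n / 2ⁿ ≤ 1 gives C / 2ⁿ ≤ n ε / 2ⁿ ≤ ε.
*½^-small : ∀ C {ε} → 0ℚ < ε → ∃[ n ] C * ½^ n ≤ ε
*½^-small C {ε} 0<ε with n , h ← ≤ν* C 0<ε = n ,
  ≤-by (gap h ⊗ ℚₚ.<⇒≤ (0<½^ n) ⊕ ℚₚ.<⇒≤ 0<ε ⊗ gap (ν*½^≤1 n)) (rearrange (ν n) (½^ n))
  where
  rearrange : ∀ m p → ε ≡ C * p + ((m * ε - C) * p + ε * (1ℚ - m * p))
  rearrange m p = solve (ε ∷ C ∷ m ∷ p ∷ []) ℚ-ring

-- Statements about reals are reduced to statements about the rationals
-- seq x n that hold for all large n.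

Ev : (ℕ → Set) → Set
Ev P = ∃[ N ] (∀ n → N ℕ.≤ n → P n)

private variable
  P Q : ℕ → Set

always : (∀ n → P n) → Ev P
always h = 0 , λ n _ → h n

Ev-map : (∀ {n} → P n → Q n) → Ev P → Ev Q
Ev-map f (N , h) = N , λ n N≤n → f (h n N≤n)

infixr 5 _⊗ᵉ_

_⊗ᵉ_ : Ev P → Ev Q → Ev (λ n → P n × Q n)
(M , h) ⊗ᵉ (N , k) = M ℕ.⊔ N , λ n ≤n →
  h n (ℕₚ.m⊔n≤o⇒m≤o M N ≤n) , k n (ℕₚ.m⊔n≤o⇒n≤o M N ≤n)

sample : Ev P → ∃[ n ] P n
sample (N , h) = N , h N ℕₚ.≤-refl

≈⇒Bd : ∀ {x y ε} → x ≈ y → 0ℚ < ε → Ev (λ n → Bd (seq x n - seq y n) ε)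
≈⇒Bd {ε = ε} x≈y 0<ε = Ev-map (λ h → ∣∣≤⇒Bd (ℚₚ.<⇒≤ h)) (x≈y ε 0<ε)

approx : ∀ x {ε} → 0ℚ < ε → ∃[ q ] Ev (λ n → Bd (seq x n - q) ε)
approx x {ε} 0<ε with N , h ← cauchy x ε 0<ε =
  seq x N , N , λ n N≤n → ∣∣≤⇒Bd (ℚₚ.<⇒≤ (h n N N≤n ℕₚ.≤-refl))

bounded : ∀ x → ∃[ m ] Ev (λ n → Bd (seq x n) (ν m))
bounded x with q , near ← approx x 0<1 with m , h ← ≤ι (1ℚ + ∣ q ∣) = m ,
  Ev-map (λ {n} b → Bd-mono h (subst (λ a → Bd a (1ℚ + ∣ q ∣))
    (rearrange (seq x n)) (Bd-+ b (Bd-∣∣ q)))) near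
  where
  rearrange : ∀ a → a - q + q ≡ a
  rearrange a = solve (a ∷ q ∷ []) ℚ-ring

-- Past a Cauchy index for ε / 4, a single violation at `n` would persist with gap ε / 2 at all
-- later indices, which is a proof of `y R.< x`. Comparison of rationals is decidable, so refuting
-- each violation suffices.
≤⇒Ev : ∀ {x y ε} → x R.≤ y → 0ℚ < ε → Ev (λ n → seq x n ≤ seq y n + ε)
≤⇒Ev {x} {y} {ε} x≤y 0<ε = N , λ n N≤n → ℚₚ.≮⇒≥ λ y+ε<x → x≤y
  (½ * ε , 0<½ ⊗< 0<ε , N , λ m N≤m →
    separate (seq x n) (seq x m) (seq y n) (seq y m) y+ε<x
      (∣∣≤⇒Bd (ℚₚ.<⇒≤ (proj₁ (near n N≤n) m N≤m)))
      (∣∣≤⇒Bd (ℚₚ.<⇒≤ (proj₂ (near n N≤n) m N≤m))))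
  where
  0<ε/4 = 0<½ ⊗< (0<½ ⊗< 0<ε)
  Near : ℝ → ℕ → ℕ → Set
  Near z N n = ∀ m → N ℕ.≤ m → ∣ seq z m - seq z n ∣ < ½ * (½ * ε)
  nears : ∀ z → ∃[ N ] (∀ n → N ℕ.≤ n → Near z N n)
  nears z with N , h ← cauchy z _ 0<ε/4 = N , λ n N≤n m N≤m → h m n N≤m N≤n
  Nx = proj₁ (nears x)
  Ny = proj₁ (nears y)
  N = Nx ℕ.⊔ Ny
  near : ∀ n → N ℕ.≤ n → Near x N n × Near y N n
  near n N≤n =
    (λ m N≤m → proj₂ (nears x) n (ℕₚ.m⊔n≤o⇒m≤o Nx Ny N≤n) m (ℕₚ.m⊔n≤o⇒m≤o Nx Ny N≤m)) ,
    (λ m N≤m → proj₂ (nears y) n (ℕₚ.m⊔n≤o⇒n≤o Nx Ny N≤n) m (ℕₚ.m⊔n≤o⇒n≤o Nx Ny N≤m))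
  separate : ∀ a a′ b b′ → b + ε < a → Bd (a′ - a) (½ * (½ * ε)) → Bd (b′ - b) (½ * (½ * ε)) →
    b′ + ½ * ε ≤ a′
  separate a a′ b b′ b+ε<a (l , _) (_ , u) =
    ≤-by (gap (ℚₚ.<⇒≤ b+ε<a) ⊕ gap l ⊕ gap u) (solve (a ∷ a′ ∷ b ∷ b′ ∷ ε ∷ []) ℚ-ring)

Ev⇒≤ : ∀ {x y} → (∀ {ε} → 0ℚ < ε → Ev (λ n → seq x n ≤ seq y n + ε)) → x R.≤ y
Ev⇒≤ {x} {y} h (ε , 0<ε , y+ε≤x)
  with n , x≤y+ε/2 , y+ε≤x ← sample (h (0<½ ⊗< 0<ε) ⊗ᵉ y+ε≤x) =
  ℚₚ.<-irrefl refl (ℚₚ.<-≤-trans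
    (<-by (0<½ ⊗< 0<ε) (rearrange (seq y n))) (ℚₚ.≤-trans y+ε≤x x≤y+ε/2))
  where
  rearrange : ∀ b → b + ε ≡ b + ½ * ε + ½ * ε
  rearrange b = solve (b ∷ ε ∷ []) ℚ-ring

fromℚ-mono-≤ : ∀ {p q} → p ≤ q → fromℚ p R.≤ fromℚ q
fromℚ-mono-≤ {p} {q} p≤q = Ev⇒≤ {fromℚ p} {fromℚ q} λ 0<ε →
  always λ _ → ≤-by (gap p≤q ⊕ ℚₚ.<⇒≤ 0<ε) (rearrange _)
  where
  rearrange : ∀ ε → q + ε ≡ p + (q - p + ε)
  rearrange ε = solve (p ∷ q ∷ ε ∷ []) ℚ-ring

fromℚ-mono-< : ∀ {p q} → p < q → fromℚ p R.< fromℚ q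
fromℚ-mono-< {p} {q} p<q = q - p , gap< p<q , always λ _ → ℚₚ.≤-reflexive rearrange
  where
  rearrange : p + (q - p) ≡ q
  rearrange = solve (p ∷ q ∷ []) ℚ-ring

Level : ℝ → ℚ → Set
Level x t = ∀ {ε} → 0ℚ < ε → Ev (λ n → Bd (seq x n - t) ε)

≤∧≥⇒Level : ∀ {x t} → x R.≤ fromℚ t → fromℚ t R.≤ x → Level x t
≤∧≥⇒Level {x} {t} x≤t t≤x {ε} 0<ε =
  Ev-map (λ {n} (p , q) → ≤-by (gap q) (rearrange (seq x n)) , ≤-by (gap p) (rearrange′ (seq x n)))
    (≤⇒Ev {x} {fromℚ t} x≤t 0<ε ⊗ᵉ ≤⇒Ev {fromℚ t} {x} t≤x 0<ε)
  where
  rearrange : ∀ a → a - t ≡ - ε + (a + ε - t)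
  rearrange a = solve (a ∷ t ∷ ε ∷ []) ℚ-ring
  rearrange′ : ∀ a → ε ≡ a - t + (t + ε - a)
  rearrange′ a = solve (a ∷ t ∷ ε ∷ []) ℚ-ring

Level⇒≤ : ∀ {x t} → Level x t → x R.≤ fromℚ t
Level⇒≤ {x} {t} h = Ev⇒≤ {x} {fromℚ t} λ {ε} 0<ε →
  Ev-map (λ {n} (_ , u) → ≤-by (gap u) (rearrange ε (seq x n))) (h 0<ε)
  where
  rearrange : ∀ ε a → t + ε ≡ a + (ε - (a - t))
  rearrange ε a = solve (a ∷ t ∷ ε ∷ []) ℚ-ring

Level⇒≥ : ∀ {x t} → Level x t → fromℚ t R.≤ x
Level⇒≥ {x} {t} h = Ev⇒≤ {fromℚ t} {x} λ {ε} 0<ε →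
  Ev-map (λ {n} (l , _) → ≤-by (gap l) (rearrange ε (seq x n))) (h 0<ε)
  where
  rearrange : ∀ ε a → a + ε ≡ t + (a - t - - ε)
  rearrange ε a = solve (a ∷ t ∷ ε ∷ []) ℚ-ring

-- Null sets

record ℚBox : Set where
  field
    left right bottom top : ℚ
    left≤right : left ≤ right
    bottom≤top : bottom ≤ top

  box : Box
  box = record
    { left = fromℚ left ; right = fromℚ right ; left≤right = fromℚ-mono-≤ left≤right
    ; bottom = fromℚ bottom ; top = fromℚ top ; bottom≤top = fromℚ-mono-≤ bottom≤top
    }

  measure : ℚ
  measure = (right - left) * (top - bottom)

  0≤measure : 0ℚ ≤ measure
  0≤measure = gap left≤right ⊗ gap bottom≤top

open ℚBox using (box; measure; 0≤measure)

total : List ℚBox → ℚ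
total []       = 0ℚ
total (B ∷ Bs) = measure B + total Bs

total-++ : ∀ Bs Cs → total (Bs ++ Cs) ≡ total Bs + total Cs
total-++ []       Cs = sym (ℚₚ.+-identityˡ (total Cs))
total-++ (B ∷ Bs) Cs = trans (cong (λ t → measure B + t) (total-++ Bs Cs))
  (sym (ℚₚ.+-assoc (measure B) (total Bs) (total Cs)))

0≤total : ∀ Bs → 0ℚ ≤ total Bs
0≤total []       = ℚₚ.≤-refl
0≤total (B ∷ Bs) = 0≤measure B ⊕ 0≤total Bs

_∈ᵇ_ : ℝ² → List ℚBox → Set
p ∈ᵇ Bs = Any (λ B → p ∈ ⟦ box B ⟧) Bs

Covered : Pred ℝ² 0ℓ → ℚ → Set
Covered A ε = Σ[ Bs ∈ List ℚBox ] (A ⊆ (_∈ᵇ Bs) × total Bs ≤ ε)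

-- Jordan content zero. Finite covers are joined by concatenating lists; the passage to sequences of
-- boxes is made only once, in `⋃-null`.
ContentZero : Pred ℝ² 0ℓ → Set
ContentZero A = ∀ {ε} → 0ℚ < ε → Covered A ε

private variable
  A B : Pred ℝ² 0ℓ

∪-covered : ∀ {δ ε} → Covered A δ → Covered B ε → Covered (A ∪ B) (δ + ε)
∪-covered (Bs , A⊆ , ≤δ) (Cs , B⊆ , ≤ε) = Bs ++ Cs ,
  (λ { (inj₁ a) → ++⁺ˡ (A⊆ a) ; (inj₂ b) → ++⁺ʳ Bs (B⊆ b) }) ,
  subst (_≤ _) (sym (total-++ Bs Cs)) (ℚₚ.+-mono-≤ ≤δ ≤ε)

halves : ∀ ε → ½ * ε + ½ * ε ≡ ε
halves ε = solve (ε ∷ []) ℚ-ring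

∪-contentZero : ContentZero A → ContentZero B → ContentZero (A ∪ B)
∪-contentZero {A} {B} a b {ε} 0<ε = subst (Covered (A ∪ B)) (halves ε)
  (∪-covered {A} {B} (a (0<½ ⊗< 0<ε)) (b (0<½ ⊗< 0<ε)))

⊆-contentZero : A ⊆ B → ContentZero B → ContentZero A
⊆-contentZero A⊆B b 0<ε with Bs , B⊆ , ≤ε ← b 0<ε = Bs , (λ a → B⊆ (A⊆B a)) , ≤ε

Any-contentZero : ∀ {I : Set} {A : I → Pred ℝ² 0ℓ} → (∀ i → ContentZero (A i)) →
  ∀ is → ContentZero (λ p → Any (λ i → p ∈ A i) is)
Any-contentZero h []       0<ε = [] , (λ ()) , ℚₚ.<⇒≤ 0<ε
Any-contentZero {A = A} h (i ∷ is) = ⊆-contentZero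
  {B = A i ∪ (λ p → Any (λ i → p ∈ A i) is)}
  (λ { (here a) → inj₁ a ; (there a) → inj₂ a })
  (∪-contentZero {A i} (h i) (Any-contentZero h is))

-- Fills the list boundaries in flatten, which keeps flatten structurally recursive.
origin : ℚBox
origin = record
  { left = 0ℚ ; right = 0ℚ ; bottom = 0ℚ ; top = 0ℚ
  ; left≤right = ℚₚ.≤-refl ; bottom≤top = ℚₚ.≤-refl }

flatten : (ℕ → List ℚBox) → List ℚBox → ℕ → ℚBox
flatten L []       zero    = origin
flatten L []       (suc n) = flatten (λ k → L (suc k)) (L 0) n
flatten L (B ∷ Bs) zero    = B
flatten L (B ∷ Bs) (suc n) = flatten L Bs n

flatten-∈₀ : ∀ {p} L Bs → p ∈ᵇ Bs → ∃[ n ] p ∈ ⟦ box (flatten L Bs n) ⟧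
flatten-∈₀     L (_ ∷ _)  (here p∈)  = 0 , p∈
flatten-∈₀ {p} L (_ ∷ Bs) (there p∈) with n , h ← flatten-∈₀ {p} L Bs p∈ = suc n , h

flatten-∈ : ∀ {p} L Bs k → p ∈ᵇ L k → ∃[ n ] p ∈ ⟦ box (flatten L Bs n) ⟧
flatten-∈ {p} L []       zero    p∈ with n , h ← flatten-∈₀ {p} (λ k → L (suc k)) (L 0) p∈ = suc n , h
flatten-∈ {p} L []       (suc k) p∈ with n , h ← flatten-∈ {p} (λ k → L (suc k)) (L 0) k p∈ = suc n , h
flatten-∈ {p} L (_ ∷ Bs) k       p∈ with n , h ← flatten-∈ {p} L Bs k p∈ = suc n , h

sum : (ℕ → ℚ) → ℕ → ℚ
sum f zero    = 0ℚ
sum f (suc n) = f 0 + sum (λ k → f (suc k)) n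

-- `Bs` is the buffer of boxes still to be emitted and `ε` the budget for the lists not yet loaded.
-- Loading `L 0` moves ε / 2 from the budget to the buffer, and the shifted sequence satisfies the
-- hypothesis for the remaining ε / 2.
flatten-sum : ∀ {ε} L Bs → 0ℚ ≤ ε → (∀ k → total (L k) ≤ ε * ½^ (suc k)) →
  ∀ n → sum (λ i → measure (flatten L Bs i)) n ≤ total Bs + ε
flatten-sum L Bs 0≤ε h zero = 0≤total Bs ⊕ 0≤ε
flatten-sum {ε} L [] 0≤ε h (suc n) =
  ≤-by (gap (flatten-sum (λ k → L (suc k)) (L 0) (0≤½ ⊗ 0≤ε)
              (λ k → subst (total (L (suc k)) ≤_) (shift (½^ k)) (h (suc k))) n)
        ⊕ gap (h 0))
    (rearrange (sum (λ i → measure (flatten (λ k → L (suc k)) (L 0) i)) n) (total (L 0)))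
  where
  shift : ∀ p → ε * (½ * (½ * p)) ≡ ½ * ε * (½ * p)
  shift p = solve (ε ∷ p ∷ []) ℚ-ring
  rearrange : ∀ s t → 0ℚ + ε ≡ 0ℚ + s + (t + ½ * ε - s + (ε * (½ * 1ℚ) - t))
  rearrange s t = solve (ε ∷ s ∷ t ∷ []) ℚ-ring
flatten-sum {ε} L (B ∷ Bs) 0≤ε h (suc n) =
  ≤-by (gap (flatten-sum L Bs 0≤ε h n)) (rearrange (measure B) _ (total Bs))
  where
  rearrange : ∀ m s t → m + t + ε ≡ m + s + (t + ε - s)
  rearrange m s t = solve (ε ∷ m ∷ s ∷ t ∷ []) ℚ-ring

sum-last : ∀ f n → sum f (suc n) ≡ sum f n + f n
sum-last f zero    = ℚₚ.+-comm (f 0) 0ℚ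
sum-last f (suc n) = trans (cong (λ t → f 0 + t) (sum-last (λ k → f (suc k)) n))
  (sym (ℚₚ.+-assoc (f 0) _ (f (suc n))))

partialSum≡sum : ∀ (B : ℕ → ℚBox) n m →
  seq (partialSum (λ k → boxArea (box (B k))) n) m ≡ sum (λ k → measure (B k)) n
partialSum≡sum B zero    m = refl
partialSum≡sum B (suc n) m =
  trans (cong (λ t → t + measure (B n)) (partialSum≡sum B n m)) (sym (sum-last (λ k → measure (B k)) n))

⋃-null : ∀ {A : ℕ → Pred ℝ² 0ℓ} → (∀ k → ContentZero (A k)) → LebesgueNull (⋃ ℕ A)
⋃-null {A} h ε (e , 0<e , e≤ε) =
  (λ n → box (flatten L [] n)) ,
  (λ {p} (k , p∈) → flatten-∈ {p} L [] k (proj₁ (proj₂ (cover k)) p∈)) ,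
  λ n → Ev⇒≤ {partialSum (λ k → boxArea (box (flatten L [] k))) n} {ε} λ {δ} 0<δ → Ev-map
    (λ {m} e≤ε → subst (_≤ seq ε m + δ) (sym (partialSum≡sum (flatten L []) n m))
      (≤-by (gap (flatten-sum L [] (ℚₚ.<⇒≤ 0<e) (λ k → proj₂ (proj₂ (cover k))) n)
             ⊕ gap e≤ε ⊕ ℚₚ.<⇒≤ 0<δ) (rearrange (sum (λ k → measure (flatten L [] k)) n) (seq ε m) δ)))
    e≤ε
  where
  -- `e` is the rational inside the proof of `0ℝ < ε`; the shares e / 2^(k+1) add up to at most `e`,
  -- which lies below the terms of `ε` from some index on.
  cover : ∀ k → Covered (A k) (e * ½^ (suc k))
  cover k = h k (0<e ⊗< 0<½^ (suc k))
  L : ℕ → List ℚBox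
  L k = proj₁ (cover k)
  rearrange : ∀ s a δ → a + δ ≡ s + (0ℚ + e - s + (a - (0ℚ + e)) + δ)
  rearrange s a δ = solve (e ∷ s ∷ a ∷ δ ∷ []) ℚ-ring

<⇒R≤ : ∀ {x y} → x R.< y → x R.≤ y
<⇒R≤ {x} {y} (ε , 0<ε , x+ε≤y) = Ev⇒≤ {x} {y} λ {δ} 0<δ →
  Ev-map (λ {n} h → ≤-by (gap h ⊕ ℚₚ.<⇒≤ 0<ε ⊕ ℚₚ.<⇒≤ 0<δ) (rearrange δ (seq x n) (seq y n))) x+ε≤y
  where
  rearrange : ∀ δ a b → b + δ ≡ a + (b - (a + ε) + ε + δ)
  rearrange δ a b = solve (ε ∷ δ ∷ a ∷ b ∷ []) ℚ-ring

≤-eventually : ∀ {x y} → Ev (λ n → seq x n ≤ seq y n) → x R.≤ y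
≤-eventually {x} {y} h = Ev⇒≤ {x} {y} λ {δ} 0<δ →
  Ev-map (λ {n} h → ≤-by (gap h ⊕ ℚₚ.<⇒≤ 0<δ) (rearrange δ (seq x n) (seq y n))) h
  where
  rearrange : ∀ δ a b → b + δ ≡ a + (b - a + δ)
  rearrange δ a b = solve (δ ∷ a ∷ b ∷ []) ℚ-ring

-- Covering Lipschitz graphs

-- Here `x` depends on `y` with constant `K`. Since δ is positive, it can double as the error
-- allowed in equations that hold only in the limit.
Lipschitz : ℚ → Pred ℝ² 0ℓ → Set
Lipschitz K A = ∀ {x y x′ y′ δ} → A (x , y) → A (x′ , y′) → 0ℚ < δ →
  Ev (λ n → Bd (seq y n - seq y′ n) δ) → Ev (λ n → Bd (seq x n - seq x′ n) (K * δ))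

Strip : Pred ℝ² 0ℓ → ℚ → ℚ → Pred ℝ² 0ℓ
Strip A c h (x , y) = A (x , y) × fromℚ c R.≤ y × y R.≤ fromℚ (c + h)

module _ (em : ExcludedMiddle 0ℓ) {K : ℚ} (0≤K : 0ℚ ≤ K) {A : Pred ℝ² 0ℓ} (lip : Lipschitz K A) where

  private
    -- Ordinates in a strip of height h differ by at most 2 h termwise, slack included, so abscissas
    -- differ by at most 2 K h; the 1 pays for replacing the abscissa of the reference point by a
    -- rational within h.
    w : ℚ
    w = K + K + 1ℚ

    0≤w : 0ℚ ≤ w
    0≤w = 0≤K ⊕ 0≤K ⊕ 0≤1

  strip-box : ∀ c {h} → 0ℚ < h → ∀ {p} → Strip A c h p → Covered (Strip A c h) ((w + w) * (h * h))
  strip-box c {h} 0<h {x₀ , y₀} (a₀ , c≤y₀ , y₀≤c+h) with q , x₀≈q ← approx x₀ 0<h =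
    hull ∷ [] , (λ { {x , y} → inside x y }) , ℚₚ.≤-reflexive (area-eq w)
    where
    0≤h = ℚₚ.<⇒≤ 0<h
    0≤wh = 0≤w ⊗ 0≤h
    widen : ∀ r → q + r ≡ q - r + (r + r)
    widen r = solve (q ∷ r ∷ []) ℚ-ring
    hull : ℚBox
    hull = record
      { left = q - w * h ; right = q + w * h ; bottom = c ; top = c + h
      ; left≤right = ≤-by (0≤wh ⊕ 0≤wh) (widen (w * h))
      ; bottom≤top = ≤-by 0≤h refl
      }
    area-eq : ∀ w → (q + w * h - (q - w * h)) * (c + h - c) + 0ℚ ≡ (w + w) * (h * h)
    area-eq w = solve (q ∷ w ∷ h ∷ c ∷ []) ℚ-ring
    rearrange : ∀ b b₀ → h + h ≡ b - b₀ + (c + h + ½ * h - b + (b₀ + ½ * h - c))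
    rearrange b b₀ = solve (b ∷ b₀ ∷ c ∷ h ∷ []) ℚ-ring
    rearrange′ : ∀ b b₀ → b - b₀ ≡ - (h + h) + (c + h + ½ * h - b₀ + (b + ½ * h - c))
    rearrange′ b b₀ = solve (b ∷ b₀ ∷ c ∷ h ∷ []) ℚ-ring
    rearrange-l : ∀ a a₀ → a ≡ q - (K + K + 1ℚ) * h + (a - a₀ - - (K * (h + h)) + (a₀ - q - - h))
    rearrange-l a a₀ = solve (a ∷ a₀ ∷ q ∷ K ∷ h ∷ []) ℚ-ring
    rearrange-u : ∀ a a₀ → q + (K + K + 1ℚ) * h ≡ a + (K * (h + h) - (a - a₀) + (h - (a₀ - q)))
    rearrange-u a a₀ = solve (a ∷ a₀ ∷ q ∷ K ∷ h ∷ []) ℚ-ring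
    0<h/2 = 0<½ ⊗< 0<h
    inside : ∀ x y → Strip A c h (x , y) → (x , y) ∈ᵇ (hull ∷ [])
    inside x y (a , c≤y , y≤c+h) = here
      ((≤-eventually {fromℚ (q - w * h)} {x} (Ev-map (λ {n} ((l , _) , (l₀ , _)) →
          ≤-by (gap l ⊕ gap l₀) (rearrange-l (seq x n) (seq x₀ n))) near)
      , ≤-eventually {x} {fromℚ (q + w * h)} (Ev-map (λ {n} ((_ , u) , (_ , u₀)) →
          ≤-by (gap u ⊕ gap u₀) (rearrange-u (seq x n) (seq x₀ n))) near))
      , c≤y , y≤c+h)
      where
      near-y : Ev (λ n → Bd (seq y n - seq y₀ n) (h + h))
      near-y = Ev-map (λ {n} (c≤ , ≤c+h , c≤₀ , ≤c+h₀) →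
          ≤-by (gap ≤c+h₀ ⊕ gap c≤) (rearrange′ (seq y n) (seq y₀ n)) ,
          ≤-by (gap ≤c+h ⊕ gap c≤₀) (rearrange (seq y n) (seq y₀ n)))
        (≤⇒Ev {fromℚ c} {y} c≤y 0<h/2 ⊗ᵉ ≤⇒Ev {y} {fromℚ (c + h)} y≤c+h 0<h/2 ⊗ᵉ
         ≤⇒Ev {fromℚ c} {y₀} c≤y₀ 0<h/2 ⊗ᵉ ≤⇒Ev {y₀} {fromℚ (c + h)} y₀≤c+h 0<h/2)
      near = lip a a₀ (0≤h ⊕< 0<h) near-y ⊗ᵉ x₀≈q

  -- Each bisection doubles the number of strips and divides the area of each box by 4, so the total
  -- is halved. Excluded middle decides whether a strip meets `A`, since `strip-box` needs a point
  -- to build its box around, and which half contains a given point.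
  strip-covered : ∀ d c {h} → 0ℚ < h → Covered (Strip A c h) ((w + w) * (h * h) * ½^ d)
  strip-covered zero c {h} 0<h with em {∃[ p ] Strip A c h p}
  ... | yes (_ , a) = subst (Covered (Strip A c h)) (sym (ℚₚ.*-identityʳ _)) (strip-box c 0<h a)
  ... | no  empty   = [] , (λ {p} a → contradiction (p , a) empty) ,
    (0≤w ⊕ 0≤w) ⊗ (ℚₚ.<⇒≤ 0<h ⊗ ℚₚ.<⇒≤ 0<h) ⊗ 0≤1
  strip-covered (suc d) c {h} 0<h
    with Bs , ⊆Bs , ≤ε ← ∪-covered {A = Strip A c (½ * h)} {B = Strip A (c + ½ * h) (½ * h)}
           (strip-covered d c (0<½ ⊗< 0<h)) (strip-covered d (c + ½ * h) (0<½ ⊗< 0<h))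
    = Bs , (λ { {x , y} s → ⊆Bs (split x y s) }) , subst (total Bs ≤_) (quarter w (½^ d)) ≤ε
    where
    quarter : ∀ w p → (w + w) * (½ * h * (½ * h)) * p + (w + w) * (½ * h * (½ * h)) * p ≡
      (w + w) * (h * h) * (½ * p)
    quarter w p = solve (w ∷ h ∷ p ∷ []) ℚ-ring
    c+h : c + h ≡ c + ½ * h + ½ * h
    c+h = solve (c ∷ h ∷ []) ℚ-ring
    split : ∀ x y → Strip A c h (x , y) →
      (Strip A c (½ * h) ∪ Strip A (c + ½ * h) (½ * h)) (x , y)
    split x y (a , c≤y , y≤c+h) with em {fromℚ (c + ½ * h) R.< y}
    ... | yes m<y = inj₂ (a , <⇒R≤ {fromℚ (c + ½ * h)} {y} m<y ,
      subst (λ q → y R.≤ fromℚ q) c+h y≤c+h)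
    ... | no  y≤m = inj₁ (a , c≤y , y≤m)

  lipschitz-contentZero : ∀ m → (∀ {x y} → A (x , y) → Ev (λ n → Bd (seq y n) (ν m))) →
    ContentZero A
  lipschitz-contentZero m bd {ε} 0<ε =
    let d , small      = *½^-small ((w + w) * (h * h)) 0<ε
        Bs , ⊆Bs , ≤ε = strip-covered d (- ν m) 0<h
    in Bs , (λ { {x , y} a → ⊆Bs (inside x y a) }) , ℚₚ.≤-trans ≤ε small
    where
    h : ℚ
    -- The strip starting at `- ν m` must reach `ν m`; the extra 1 keeps the height positive when
    -- `m` is 0.
    h = ν m + ν m + 1ℚ
    0<h : 0ℚ < h
    0<h = 0≤ν m ⊕ 0≤ν m ⊕< 0<1
    rearrange : ∀ k b → - k + (k + k + 1ℚ) ≡ b + (k - b + 1ℚ)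
    rearrange k b = solve (k ∷ b ∷ []) ℚ-ring
    inside : ∀ x y → A (x , y) → Strip A (- ν m) h (x , y)
    inside x y a = a , ≤-eventually {fromℚ (- ν m)} {y} (Ev-map proj₁ (bd a)) ,
      ≤-eventually {y} {fromℚ (- ν m + h)}
        (Ev-map (λ {n} (_ , u) → ≤-by (gap u ⊕ 0≤1) (rearrange (ν m) (seq y n))) (bd a))

-- Level curves of the real and imaginary parts of z²

Re² Im² : ℝ² → ℝ
Re² (x , y) = x R.* x R.- y R.* y
Im² (x , y) = x R.* y R.+ x R.* y

-- Stands in for division in the slope estimates: the factor multiplying `a - a′` is first scaled to
-- be at least 1 and then dropped.
Bd-unscale : ∀ {a σ G} → 1ℚ ≤ σ → Bd (σ * a) G → Bd a G
Bd-unscale {a} {σ} {G} 1≤σ (l , u) with ℚₚ.≤-total 0ℚ a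
... | inj₁ 0≤a = ≤-by (0≤½ ⊗ (gap l ⊕ gap u) ⊕ 0≤a) (solve (a ∷ σ ∷ G ∷ []) ℚ-ring) ,
                 ≤-by (gap u ⊕ gap 1≤σ ⊗ 0≤a) (solve (a ∷ σ ∷ G ∷ []) ℚ-ring)
... | inj₂ a≤0 = ≤-by (gap l ⊕ gap 1≤σ ⊗ gap a≤0) (solve (a ∷ σ ∷ G ∷ []) ℚ-ring) ,
                 ≤-by (0≤½ ⊗ (gap l ⊕ gap u) ⊕ gap a≤0) (solve (a ∷ σ ∷ G ∷ []) ℚ-ring)

Bd-neg : ∀ {a A} → Bd a A → Bd (- a) A
Bd-neg {a} {A} (l , u) = ℚₚ.neg-antimono-≤ u , ≤-by (gap l) (solve (a ∷ A ∷ []) ℚ-ring)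

Bd-by : ∀ {a b A B} → Bd a A → a ≡ b → A ≡ B → Bd b B
Bd-by h refl refl = h

1≤+ : ∀ {a b} → 1ℚ ≤ a → 1ℚ ≤ b → 1ℚ ≤ a + b
1≤+ {a} {b} 1≤a 1≤b = ≤-by (gap 1≤a ⊕ gap 1≤b ⊕ 0≤1) (solve (a ∷ b ∷ []) ℚ-ring)

-- (a − a′) (a + a′) = (b − b′) (b + b′) + (a² − b² − t) − (a′² − b′² − t)
Re²-slope : ∀ {M N a b a′ b′ t δ} → 1ℚ ≤ M * a → 1ℚ ≤ M * a′ → Bd b N → Bd b′ N → Bd (b - b′) δ →
  Bd (a * a - b * b - t) δ → Bd (a′ * a′ - b′ * b′ - t) δ →
  Bd (a - a′) (∣ M ∣ * (N + N + 1ℚ + 1ℚ) * δ)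
Re²-slope {M} {N} {a} {b} {a′} {b′} {t} {δ} 1≤Ma 1≤Ma′ hb hb′ hbb hX hX′ =
  Bd-unscale (1≤+ 1≤Ma 1≤Ma′)
  (Bd-by (Bd-* (Bd-∣∣ M) (Bd-+ (Bd-* hbb (Bd-+ hb hb′)) (Bd-+ hX (Bd-neg hX′))))
    rearrange (collect ∣ M ∣))
  where
  rearrange : M * ((b - b′) * (b + b′) + (a * a - b * b - t + - (a′ * a′ - b′ * b′ - t))) ≡
    (M * a + M * a′) * (a - a′)
  rearrange = solve (M ∷ a ∷ a′ ∷ b ∷ b′ ∷ t ∷ []) ℚ-ring
  collect : ∀ m → m * (δ * (N + N) + (δ + δ)) ≡ m * (N + N + 1ℚ + 1ℚ) * δ
  collect m = solve (m ∷ δ ∷ N ∷ []) ℚ-ring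

-- (a − a′) b = (a b − a′ b′) + a′ (b′ − b)
Im²-slope : ∀ {M N a b a′ b′ t δ} → 1ℚ ≤ M * b → Bd a′ N → Bd (b - b′) δ →
  Bd (a * b + a * b - t) δ → Bd (a′ * b′ + a′ * b′ - t) δ →
  Bd (a - a′) (∣ M ∣ * (N + 1ℚ) * δ)
Im²-slope {M} {N} {a} {b} {a′} {b′} {t} {δ} 1≤Mb ha′ hbb hX hX′ = Bd-unscale 1≤Mb
  (Bd-by (Bd-* (Bd-∣∣ M) (Bd-+ (Bd-* (Bd-∣∣ ½) (Bd-+ hX (Bd-neg hX′))) (Bd-* ha′ (Bd-neg hbb))))
    rearrange (collect ∣ M ∣))
  where
  rearrange : M * (½ * (a * b + a * b - t + - (a′ * b′ + a′ * b′ - t)) + a′ * - (b - b′)) ≡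
    M * b * (a - a′)
  rearrange = solve (M ∷ a ∷ a′ ∷ b ∷ b′ ∷ t ∷ []) ℚ-ring
  collect : ∀ m → m * (½ * (δ + δ) + N * δ) ≡ m * (N + 1ℚ) * δ
  collect m = solve (m ∷ δ ∷ N ∷ []) ℚ-ring

-- On these pieces `x` is ±√(y² + t), respectively t / (2 y), with a Lipschitz constant depending on
-- `M` and `N`. The sign of `M` fixes the side of the axis, so that x + x′ cannot cancel between two
-- points of one piece, and 1 / ∣M∣ is the distance kept from the axis.
SteepRe² SteepIm² : ℤ → ℕ → ℚ → Pred ℝ² 0ℓ
SteepRe² M N t p@(x , y) =
  Ev (λ n → 1ℚ ≤ ι M * seq x n × Bd (seq y n) (ν N)) × Level (Re² p) t
SteepIm² M N t p@(x , y) =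
  Ev (λ n → 1ℚ ≤ ι M * seq y n × Bd (seq x n) (ν N) × Bd (seq y n) (ν N)) × Level (Im² p) t

VerticalAxis HorizontalAxis : ℕ → Pred ℝ² 0ℓ
VerticalAxis   N (x , y) = Level x 0ℚ × Ev (λ n → Bd (seq y n) (ν N))
HorizontalAxis N (x , y) = Level y 0ℚ × Ev (λ n → Bd (seq x n) (ν N))

Bd⇒between : ∀ {x q} → Ev (λ n → Bd (seq x n) q) → fromℚ (- q) R.≤ x × x R.≤ fromℚ q
Bd⇒between {x} {q} h =
  ≤-eventually {fromℚ (- q)} {x} (Ev-map proj₁ h) , ≤-eventually {x} {fromℚ q} (Ev-map proj₂ h)

-ν≤ν : ∀ N → - ν N ≤ ν N
-ν≤ν N = ℚₚ.≤-trans (ℚₚ.neg-antimono-≤ (0≤ν N)) (0≤ν N)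

verticalAxis-contentZero : ∀ N → ContentZero (VerticalAxis N)
verticalAxis-contentZero N {ε} 0<ε =
  record { left = 0ℚ ; right = 0ℚ ; bottom = - ν N ; top = ν N
         ; left≤right = ℚₚ.≤-refl ; bottom≤top = -ν≤ν N } ∷ [] ,
  (λ { {x , y} (x≈0 , bd) → here ((Level⇒≥ {x} {0ℚ} x≈0 , Level⇒≤ {x} {0ℚ} x≈0) , Bd⇒between {y} bd) }) ,
  ≤-by (ℚₚ.<⇒≤ 0<ε) (degenerate (ν N))
  where
  degenerate : ∀ m → ε ≡ (0ℚ - 0ℚ) * (m - - m) + 0ℚ + ε
  degenerate m = solve (m ∷ ε ∷ []) ℚ-ring

horizontalAxis-contentZero : ∀ N → ContentZero (HorizontalAxis N)
horizontalAxis-contentZero N {ε} 0<ε =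
  record { left = - ν N ; right = ν N ; bottom = 0ℚ ; top = 0ℚ
         ; left≤right = -ν≤ν N ; bottom≤top = ℚₚ.≤-refl } ∷ [] ,
  (λ { {x , y} (y≈0 , bd) → here (Bd⇒between {x} bd , (Level⇒≥ {y} {0ℚ} y≈0 , Level⇒≤ {y} {0ℚ} y≈0)) }) ,
  ≤-by (ℚₚ.<⇒≤ 0<ε) (degenerate (ν N))
  where
  degenerate : ∀ m → ε ≡ (m - - m) * (0ℚ - 0ℚ) + 0ℚ + ε
  degenerate m = solve (m ∷ ε ∷ []) ℚ-ring

module _ (em : ExcludedMiddle 0ℓ) where

  steepRe²-contentZero : ∀ M N t → ContentZero (SteepRe² M N t)
  steepRe²-contentZero M N t = lipschitz-contentZero em {∣ ι M ∣ * (ν N + ν N + 1ℚ + 1ℚ)}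
    (ℚₚ.0≤∣p∣ (ι M) ⊗ (0≤ν N ⊕ 0≤ν N ⊕ 0≤1 ⊕ 0≤1))
    {SteepRe² M N t} (λ {x} {y} {x′} {y′} {δ} (h , X) (h′ , X′) 0<δ hyy → Ev-map
      (λ {n} ((m , b) , (m′ , b′) , bb , X , X′) →
        Re²-slope {ι M} {ν N} {seq x n} {seq y n} {seq x′ n} {seq y′ n} {t} {δ}
          m m′ b b′ bb X X′)
      (h ⊗ᵉ h′ ⊗ᵉ hyy ⊗ᵉ X 0<δ ⊗ᵉ X′ 0<δ))
    N (λ (h , _) → Ev-map proj₂ h)

  steepIm²-contentZero : ∀ M N t → ContentZero (SteepIm² M N t)
  steepIm²-contentZero M N t = lipschitz-contentZero em {∣ ι M ∣ * (ν N + 1ℚ)}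
    (ℚₚ.0≤∣p∣ (ι M) ⊗ (0≤ν N ⊕ 0≤1))
    {SteepIm² M N t} (λ {x} {y} {x′} {y′} {δ} (h , X) (h′ , X′) 0<δ hyy → Ev-map
      (λ {n} ((m , _ , _) , (_ , a′ , _) , bb , X , X′) →
        Im²-slope {ι M} {ν N} {seq x n} {seq y n} {seq x′ n} {seq y′ n} {t} {δ}
          m a′ bb X X′)
      (h ⊗ᵉ h′ ⊗ᵉ hyy ⊗ᵉ X 0<δ ⊗ᵉ X′ 0<δ))
    N (λ (h , _) → Ev-map (λ (_ , _ , b) → b) h)

-- Exhausting the level curves by sets of content zero

range : ℕ → List ℤ
range n = map +_ (upTo (suc n)) ++ map (λ k → ℤ.- + k) (upTo (suc n))

∈-range : ∀ {n} k → ℤ.∣ k ∣ ℕ.≤ n → k ∈ˡ range n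
∈-range (+ k) k≤n = ∈-++⁺ˡ (∈-map⁺ +_ (∈-upTo⁺ (ℕ.s≤s k≤n)))
∈-range {n} -[1+ k ] k<n =
  ∈-++⁺ʳ (map +_ (upTo (suc n))) (∈-map⁺ (λ k → ℤ.- + k) (∈-upTo⁺ (ℕ.s≤s k<n)))

-- A nonzero real comes with a rational ε bounding it away from 0; `m` is an integer of the same
-- sign whose absolute value is at least 1 / ε.
steep : ExcludedMiddle 0ℓ → ∀ x → Level x 0ℚ ⊎ ∃[ m ] Ev (λ n → 1ℚ ≤ ι m * seq x n)
steep em x with em {0ℝ R.< x} | em {x R.< 0ℝ}
... | no x≤0 | no 0≤x = inj₁ (≤∧≥⇒Level {x} {0ℚ} x≤0 0≤x)
... | yes (ε , 0<ε , ε≤x) | _ with m , 1≤mε ← ≤ν* 1ℚ 0<ε =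
  inj₂ (+ m , Ev-map (λ {n} ε≤x → ≤-by (gap 1≤mε ⊕ 0≤ν m ⊗ gap ε≤x) (rearrange (ν m) (seq x n))) ε≤x)
  where
  rearrange : ∀ m a → m * a ≡ 1ℚ + (m * ε - 1ℚ + m * (a - (0ℚ + ε)))
  rearrange m a = solve (m ∷ a ∷ ε ∷ []) ℚ-ring
... | no _ | yes (ε , 0<ε , x≤-ε) with m , 1≤mε ← ≤ν* 1ℚ 0<ε =
  inj₂ (ℤ.- + m , Ev-map (λ {n} x≤-ε → subst (λ μ → 1ℚ ≤ μ * seq x n) (sym (ι-neg (+ m)))
    (≤-by (gap 1≤mε ⊕ 0≤ν m ⊗ gap x≤-ε) (rearrange (ν m) (seq x n)))) x≤-ε)
  where
  rearrange : ∀ m a → - m * a ≡ 1ℚ + (m * ε - 1ℚ + m * (0ℚ - (a + ε)))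
  rearrange m a = solve (m ∷ a ∷ ε ∷ []) ℚ-ring

module _ (em : ExcludedMiddle 0ℓ) (t : ℤ → ℚ) where

  OnLevels : Pred ℝ² 0ℓ
  OnLevels p = ∃[ k ] (Level (Re² p) (t k) ⊎ Level (Im² p) (t k))

  Piece : ℕ → ℤ → ℤ → Pred ℝ² 0ℓ
  Piece N M k = SteepRe² M N (t k) ∪ SteepIm² M N (t k)

  -- One number bounds the coordinates, the steepness and the index of the level together, so each
  -- stage is a finite union, while a point of a level curve enters at the maximum of its own
  -- bounds.
  Stage : ℕ → Pred ℝ² 0ℓ
  Stage N = (VerticalAxis N ∪ HorizontalAxis N) ∪
    (λ p → Any (λ M → Any (λ k → p ∈ Piece N M k) (range N)) (range N))

  stage-contentZero : ∀ N → ContentZero (Stage N)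
  stage-contentZero N = ∪-contentZero {VerticalAxis N ∪ HorizontalAxis N}
    (∪-contentZero {VerticalAxis N} {HorizontalAxis N}
      (verticalAxis-contentZero N) (horizontalAxis-contentZero N))
    (Any-contentZero {A = λ M p → Any (λ k → p ∈ Piece N M k) (range N)}
      (λ M → Any-contentZero {A = Piece N M}
        (λ k → ∪-contentZero {SteepRe² M N (t k)} {SteepIm² M N (t k)}
          (steepRe²-contentZero em M N (t k)) (steepIm²-contentZero em M N (t k)))
        (range N))
      (range N))

  onLevels⊆stages : OnLevels ⊆ ⋃ ℕ Stage
  onLevels⊆stages {p@(x , y)} (k , level) = go (steep em x) (steep em y)
    where
    bx by : ℕ
    bx = proj₁ (bounded x)
    by = proj₁ (bounded y)
    hx : Ev (λ n → Bd (seq x n) (ν bx))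
    hx = proj₂ (bounded x)
    hy : Ev (λ n → Bd (seq y n) (ν by))
    hy = proj₂ (bounded y)
    go : Level x 0ℚ ⊎ (∃[ m ] Ev (λ n → 1ℚ ≤ ι m * seq x n)) →
         Level y 0ℚ ⊎ (∃[ m ] Ev (λ n → 1ℚ ≤ ι m * seq y n)) → p ∈ ⋃ ℕ Stage
    go (inj₁ x≈0) _          = by , inj₁ (inj₁ (x≈0 , hy))
    go (inj₂ _)   (inj₁ y≈0) = bx , inj₁ (inj₂ (y≈0 , hx))
    go (inj₂ (m , hm)) (inj₂ (m′ , hm′)) = N , inj₂ (place level)
      where
      N : ℕ
      N = bx ℕ.⊔ by ℕ.⊔ (ℤ.∣ m ∣ ℕ.⊔ ℤ.∣ m′ ∣ ℕ.⊔ ℤ.∣ k ∣)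
      mm′≤ : ℤ.∣ m ∣ ℕ.⊔ ℤ.∣ m′ ∣ ℕ.≤ N
      mm′≤ = ℕₚ.≤-trans (ℕₚ.m≤m⊔n _ ℤ.∣ k ∣) (ℕₚ.m≤n⊔m (bx ℕ.⊔ by) _)
      k≤ : ℤ.∣ k ∣ ℕ.≤ N
      k≤ = ℕₚ.≤-trans (ℕₚ.m≤n⊔m (ℤ.∣ m ∣ ℕ.⊔ ℤ.∣ m′ ∣) _) (ℕₚ.m≤n⊔m (bx ℕ.⊔ by) _)
      hx′ : Ev (λ n → Bd (seq x n) (ν N))
      hx′ = Ev-map (Bd-mono (ν-mono (ℕₚ.≤-trans (ℕₚ.m≤m⊔n bx by) (ℕₚ.m≤m⊔n _ _)))) hx
      hy′ : Ev (λ n → Bd (seq y n) (ν N))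
      hy′ = Ev-map (Bd-mono (ν-mono (ℕₚ.≤-trans (ℕₚ.m≤n⊔m bx by) (ℕₚ.m≤m⊔n _ _)))) hy
      place : Level (Re² p) (t k) ⊎ Level (Im² p) (t k) →
        Any (λ M → Any (λ k → p ∈ Piece N M k) (range N)) (range N)
      place (inj₁ X) = lose (∈-range m (ℕₚ.≤-trans (ℕₚ.m≤m⊔n _ _) mm′≤))
        (lose (∈-range k k≤) (inj₁ (hm ⊗ᵉ hy′ , X)))
      place (inj₂ Y) = lose (∈-range m′ (ℕₚ.≤-trans (ℕₚ.m≤n⊔m ℤ.∣ m ∣ _) mm′≤))
        (lose (∈-range k k≤) (inj₂ (hm′ ⊗ᵉ hx′ ⊗ᵉ hy′ , Y)))

  onLevels-null : LebesgueNull OnLevels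
  onLevels-null ε 0<ε =
    let B , ⊆B , ≤ε = ⋃-null {A = Stage} stage-contentZero ε 0<ε
    in B , (λ {p} p∈ → ⊆B {p} (onLevels⊆stages {p} p∈)) , ≤ε

-- The coloring

opaque

  -- Opaque so that it acts as an atom in grid computations; `side≡7/10` releases the value where
  -- numbers matter.
  side : ℚ
  side = + 7 / 10

  side≡7/10 : side ≡ + 7 / 10
  side≡7/10 = refl

  0<side : 0ℚ < side
  0<side = ℚₚ.positive⁻¹ side

grid : ℤ → ℚ
grid k = ι k * side

0≤side : 0ℚ ≤ side
0≤side = ℚₚ.<⇒≤ 0<side

grid-mono : ∀ {k l} → k ℤ.≤ l → grid k ≤ grid l
grid-mono k≤l = ℚₚ.*-monoʳ-≤-nonNeg side {{nonNegative 0≤side}} (ι-mono k≤l)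

-- Cells on the real line

InCell : ℤ → ℝ → Set
InCell k X = fromℚ (grid k) R.≤ X × X R.< fromℚ (grid (ℤ.suc k))

<-≤-transʳ : ∀ {X p q} → X R.< fromℚ p → p ≤ q → X R.< fromℚ q
<-≤-transʳ (ε , 0<ε , h) p≤q = ε , 0<ε , Ev-map (λ X+ε≤p → ℚₚ.≤-trans X+ε≤p p≤q) h

InCell-unique : ∀ {k l X} → InCell k X → InCell l X → k ≡ l
InCell-unique {k} {l} {X} (k≤X , X<k+1) (l≤X , X<l+1) with ℤₚ.<-cmp k l
... | tri< k<l _ _ = contradiction (<-≤-transʳ {X} X<k+1 (grid-mono (ℤₚ.i<j⇒suc[i]≤j k<l))) l≤X
... | tri≈ _ k≡l _ = k≡l
... | tri> _ _ l<k = contradiction (<-≤-transʳ {X} X<l+1 (grid-mono (ℤₚ.i<j⇒suc[i]≤j l<k))) k≤X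

-- A linear search for the integer part of X / side: `j` counts the cells left, and excluded middle
-- compares `X` with the next grid line.
InCell-between : ExcludedMiddle 0ℓ → ∀ {X} j k → fromℚ (grid k) R.≤ X →
  X R.< fromℚ (grid (+ j ℤ.+ k)) → ∃[ l ] InCell l X
InCell-between em {X} zero k k≤X X<k =
  contradiction (subst (λ k → X R.< fromℚ (grid k)) (ℤₚ.+-identityˡ k) X<k) k≤X
InCell-between em {X} (suc j) k k≤X X<k+j with em {X R.< fromℚ (grid (ℤ.suc k))}
... | yes X<k+1 = k , k≤X , X<k+1
... | no  k+1≤X = InCell-between em {X} j (ℤ.suc k) k+1≤X
  (subst (λ k → X R.< fromℚ (grid k)) shift X<k+j)
  where
  shift : + suc j ℤ.+ k ≡ + j ℤ.+ ℤ.suc k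
  shift = trans (cong (λ i → i ℤ.+ k) (ℤₚ.+-comm (+ 1) (+ j))) (ℤₚ.+-assoc (+ j) (+ 1) k)

grid-neg : ∀ n → grid (ℤ.- + n) ≡ - ν n * side
grid-neg n = cong (λ q → q * side) (ι-neg (+ n))

InCell-bounded : ExcludedMiddle 0ℓ → ∀ {X} m n → Ev (λ i → Bd (seq X i) (ν m)) →
  ν m + 1ℚ ≤ ν n * side → ∃[ k ] InCell k X
-- The search covers the 2 n cells from -n to n; the spare 1 in the hypothesis makes the upper bound
-- strict.
InCell-bounded em {X} m n bd h = InCell-between em {X} (n ℕ.+ n) (ℤ.- + n)
  (subst (λ q → fromℚ q R.≤ X) (sym (grid-neg n)) lower)
  (subst (λ k → X R.< fromℚ (grid k)) (sym cancel) upper)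
  where
  lower-by : ∀ {m ns a} → m + 1ℚ ≤ ns → - m ≤ a → - ns ≤ a
  lower-by {m} {ns} {a} h l = ≤-by (gap l ⊕ gap h ⊕ 0≤1) rearrange
    where
    rearrange : a ≡ - ns + (a - - m + (ns - (m + 1ℚ)) + 1ℚ)
    rearrange = solve (m ∷ ns ∷ a ∷ []) ℚ-ring
  upper-by : ∀ {m ns a} → m + 1ℚ ≤ ns → a ≤ m → a + 1ℚ ≤ ns
  upper-by {m} {ns} {a} h u = ≤-by (gap u ⊕ gap h) rearrange
    where
    rearrange : ns ≡ a + 1ℚ + (m - a + (ns - (m + 1ℚ)))
    rearrange = solve (m ∷ ns ∷ a ∷ []) ℚ-ring
  lower : fromℚ (- ν n * side) R.≤ X
  lower = ≤-eventually {fromℚ (- ν n * side)} {X} (Ev-map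
    (λ {i} (l , _) → subst (λ q → q ≤ seq X i) (ℚₚ.neg-distribˡ-* (ν n) side) (lower-by h l)) bd)
  upper : X R.< fromℚ (ν n * side)
  upper = 1ℚ , 0<1 , Ev-map (λ {i} (_ , u) → upper-by {ν m} {ν n * side} {seq X i} h u) bd
  cancel : + (n ℕ.+ n) ℤ.+ (ℤ.- + n) ≡ + n
  cancel = trans (ℤₚ.+-assoc (+ n) (+ n) (ℤ.- + n))
    (trans (cong (λ i → + n ℤ.+ i) (ℤₚ.+-inverseʳ (+ n))) (ℤₚ.+-identityʳ (+ n)))

InCell-exists : ExcludedMiddle 0ℓ → ∀ X → ∃[ k ] InCell k X
InCell-exists em X =
  let m , bd = bounded X
      n , h  = ≤ν* (ν m + 1ℚ) 0<side
  in InCell-bounded em {X} m n bd h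

-- Openness of strict bounds and continuity of squaring

Near : ℚ → ℝ → ℝ → Set
Near η X X′ = Ev (λ n → Bd (seq X′ n - seq X n) η)

Near-sym : ∀ {η X X′} → Near η X X′ → Near η X′ X
Near-sym {X = X} {X′} = Ev-map (λ {n} → Bd-sym {seq X′ n} {seq X n})

<-open : ∀ {X b} → X R.< fromℚ b → ∃[ η ] (0ℚ < η × ∀ X′ → Near η X X′ → X′ R.< fromℚ b)
<-open {X} {b} (ε , 0<ε , h) = ½ * ε , 0<½ ⊗< 0<ε , λ X′ near → ½ * ε , 0<½ ⊗< 0<ε ,
  Ev-map (λ {n} (X+ε≤b , (_ , u)) → ≤-by (gap X+ε≤b ⊕ gap u) (rearrange (seq X n) (seq X′ n)))
    (h ⊗ᵉ near)
  where
  rearrange : ∀ a a′ → b ≡ a′ + ½ * ε + (b - (a + ε) + (½ * ε - (a′ - a)))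
  rearrange a a′ = solve (a ∷ a′ ∷ b ∷ ε ∷ []) ℚ-ring

>-open : ∀ {X a} → fromℚ a R.< X → ∃[ η ] (0ℚ < η × ∀ X′ → Near η X X′ → fromℚ a R.< X′)
>-open {X} {a} (ε , 0<ε , h) = ½ * ε , 0<½ ⊗< 0<ε , λ X′ near → ½ * ε , 0<½ ⊗< 0<ε ,
  Ev-map (λ {n} (a+ε≤X , (l , _)) → ≤-by (gap a+ε≤X ⊕ gap l) (rearrange (seq X n) (seq X′ n)))
    (h ⊗ᵉ near)
  where
  rearrange : ∀ b b′ → b′ ≡ a + ½ * ε + (b - (a + ε) + (b′ - b - - (½ * ε)))
  rearrange b b′ = solve (a ∷ b ∷ b′ ∷ ε ∷ []) ℚ-ring

InCell-open : ∀ {k X} → fromℚ (grid k) R.< X → X R.< fromℚ (grid (ℤ.suc k)) →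
  ∃[ η ] (0ℚ < η × ∀ X′ → Near η X X′ → InCell k X′)
InCell-open {k} {X} k<X X<k+1 =
  let α , 0<α , above = >-open {X} {grid k} k<X
      β , 0<β , below = <-open {X} {grid (ℤ.suc k)} X<k+1
      η , 0<η , η≤α , η≤β = min 0<α 0<β
  in η , 0<η , λ X′ near →
    <⇒R≤ {fromℚ (grid k)} {X′} (above X′ (Ev-map (Bd-mono η≤α) near)) ,
    below X′ (Ev-map (Bd-mono η≤β) near)

InCell-resp : ∀ {k X X′} → (∀ {η} → 0ℚ < η → Near η X X′) → InCell k X → InCell k X′
InCell-resp {k} {X} {X′} near (k≤X , X<k+1) =
  -- The lower bound is a negated inequality: were `X′` below the grid line, openness would put `X`
  -- below it too.
  (λ X′<k → let η , 0<η , h = <-open {X′} X′<k in k≤X (h X (Near-sym {X = X} {X′} (near 0<η)))) ,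
  (let η , 0<η , h = <-open {X} X<k+1 in h X′ (near 0<η))

Bd-product : ∀ a b a′ b′ {B δ} → δ ≤ 1ℚ → Bd a B → Bd b B → Bd (a′ - a) δ → Bd (b′ - b) δ →
  Bd (a′ * b′ - a * b) ((B + B + 1ℚ) * δ)
Bd-product a b a′ b′ {B} {δ} δ≤1 ha hb haa hbb =
  Bd-by (Bd-+ (Bd-+ (Bd-* haa hb) (Bd-* ha hbb)) (Bd-* haa (Bd-mono δ≤1 hbb))) product bound
  where
  product : (a′ - a) * b + a * (b′ - b) + (a′ - a) * (b′ - b) ≡ a′ * b′ - a * b
  product = solve (a ∷ b ∷ a′ ∷ b′ ∷ []) ℚ-ring
  bound : δ * B + B * δ + δ * 1ℚ ≡ (B + B + 1ℚ) * δ
  bound = solve (B ∷ δ ∷ []) ℚ-ring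

Near² : ℚ → ℝ² → ℝ² → Set
Near² δ (x , y) (x′ , y′) = Near δ x x′ × Near δ y y′

-- Taking δ among the powers of one half makes it at most 1, which absorbs the quadratic error term,
-- and as small as required.
square-continuous : ∀ p {η} → 0ℚ < η →
  ∃[ δ ] (0ℚ < δ × ∀ p′ → Near² δ p p′ → Near η (Re² p) (Re² p′) × Near η (Im² p) (Im² p′))
square-continuous (x , y) {η} 0<η =
  let bx , hx = bounded x
      by , hy = bounded y
      n , small = *½^-small (C bx by + C bx by) 0<η
      hx′ = Ev-map (Bd-mono (ν-mono (ℕₚ.m≤m⊔n bx by))) hx
      hy′ = Ev-map (Bd-mono (ν-mono (ℕₚ.m≤n⊔m bx by))) hy
  in ½^ n , 0<½^ n , λ { (x′ , y′) (nx , ny) →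
    Ev-map (λ {i} (a , b , aa , bb) → Bd-mono small
      (Bd-by (Bd-+ (Bd-product (seq x i) (seq x i) (seq x′ i) (seq x′ i) (½^≤1 n) a a aa aa)
                   (Bd-neg (Bd-product (seq y i) (seq y i) (seq y′ i) (seq y′ i) (½^≤1 n) b b bb bb)))
        (Re²-difference (seq x i) (seq x′ i) (seq y i) (seq y′ i)) (collect (C bx by) (½^ n))))
      (hx′ ⊗ᵉ hy′ ⊗ᵉ nx ⊗ᵉ ny) ,
    Ev-map (λ {i} (a , b , aa , bb) → Bd-mono small
      (Bd-by (Bd-+ (Bd-product (seq x i) (seq y i) (seq x′ i) (seq y′ i) (½^≤1 n) a b aa bb)
                   (Bd-product (seq x i) (seq y i) (seq x′ i) (seq y′ i) (½^≤1 n) a b aa bb))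
        (Im²-difference (seq x i) (seq x′ i) (seq y i) (seq y′ i)) (collect (C bx by) (½^ n))))
      (hx′ ⊗ᵉ hy′ ⊗ᵉ nx ⊗ᵉ ny) }
  where
  C : ℕ → ℕ → ℚ
  C bx by = ν (bx ℕ.⊔ by) + ν (bx ℕ.⊔ by) + 1ℚ
  collect : ∀ c p → c * p + c * p ≡ (c + c) * p
  collect c p = solve (c ∷ p ∷ []) ℚ-ring
  Re²-difference : ∀ a a′ b b′ →
    a′ * a′ - a * a + - (b′ * b′ - b * b) ≡ a′ * a′ - b′ * b′ - (a * a - b * b)
  Re²-difference a a′ b b′ = solve (a ∷ a′ ∷ b ∷ b′ ∷ []) ℚ-ring
  Im²-difference : ∀ a a′ b b′ →
    a′ * b′ - a * b + (a′ * b′ - a * b) ≡ a′ * b′ + a′ * b′ - (a * b + a * b)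
  Im²-difference a a′ b b′ = solve (a ∷ a′ ∷ b ∷ b′ ∷ []) ℚ-ring

Ball⇒Near² : ∀ {p q δ} → 0ℚ < δ → q ∈ Ball p (fromℚ δ) → Near² δ p q
Ball⇒Near² {x , y} {x′ , y′} {δ} 0<δ (ε , 0<ε , h) =
  Ev-map (λ {n} d → Bd-sym {seq x n} {seq x′ n} (sq≤⇒Bd 0<δ
    (≤-by (gap d ⊕ ℚₚ.<⇒≤ 0<ε ⊕ 0≤sq (seq y n - seq y′ n))
      (drop (seq x n - seq x′ n) (seq y n - seq y′ n))))) h ,
  Ev-map (λ {n} d → Bd-sym {seq y n} {seq y′ n} (sq≤⇒Bd 0<δ
    (≤-by (gap d ⊕ ℚₚ.<⇒≤ 0<ε ⊕ 0≤sq (seq x n - seq x′ n))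
      (drop′ (seq x n - seq x′ n) (seq y n - seq y′ n))))) h
  where
  drop : ∀ u v → δ * δ ≡ u * u + (δ * δ - (u * u + v * v + ε) + ε + v * v)
  drop u v = solve (u ∷ v ∷ δ ∷ ε ∷ []) ℚ-ring
  drop′ : ∀ u v → δ * δ ≡ v * v + (δ * δ - (u * u + v * v + ε) + ε + u * u)
  drop′ u v = solve (u ∷ v ∷ δ ∷ ε ∷ []) ℚ-ring

-- Colors, with a sample point for each

residue : ℤ → Fin 5
residue k = fromℕ< (ℤ.n%ℕd<d k 5)

InCells : ℤ → ℤ → Pred ℝ² 0ℓ
InCells k l p = InCell k (Re² p) × InCell l (Im² p)

cellColor : ℤ → ℤ → Fin 25
cellColor k l = combine (residue k) (residue l)

-- A relation instead of a function of the point, because the cell of a Cauchy real cannot be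
-- computed.
HasColor : Fin 25 → Pred ℝ² 0ℓ
HasColor i p = ∃[ k ] ∃[ l ] (InCells k l p × cellColor k l ≡ i)

HasColor-unique : ∀ {i j p} → HasColor i p → HasColor j p → i ≡ j
HasColor-unique {p = p} (k , l , (hk , hl) , eq) (k′ , l′ , (hk′ , hl′) , eq′) = trans (sym eq)
  (trans (cong₂ cellColor (InCell-unique {X = Re² p} hk hk′) (InCell-unique {X = Im² p} hl hl′)) eq′)

HasColor-respects : ∀ i → HasColor i Respects _≈²_
HasColor-respects i {p@(x , y)} {p′@(x′ , y′)} (x≈x′ , y≈y′) (k , l , (hk , hl) , eq) = k , l ,
  (InCell-resp {k} {Re² p} {Re² p′} (λ 0<η → proj₁ (near 0<η)) hk ,
   InCell-resp {l} {Im² p} {Im² p′} (λ 0<η → proj₂ (near 0<η)) hl) , eq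
  where
  near : ∀ {η} → 0ℚ < η → Near η (Re² p) (Re² p′) × Near η (Im² p) (Im² p′)
  near 0<η = let δ , 0<δ , h = square-continuous p 0<η in
    h p′ (Near-sym {X = x′} {x} (≈⇒Bd {x} {x′} x≈x′ 0<δ) , Near-sym {X = y′} {y} (≈⇒Bd {y} {y′} y≈y′ 0<δ))

-- Three times the coordinates of a point of each color, found by search
samples : List (ℕ × ℕ)
samples =
  (0 , 0) ∷ (2 , 2) ∷ (3 , 3)  ∷ (6 , 2)  ∷ (3 , 10) ∷
  (3 , 0) ∷ (1 , 5) ∷ (4 , 2)  ∷ (2 , 5)  ∷ (6 , 5) ∷
  (0 , 4) ∷ (1 , 4) ∷ (1 , 7)  ∷ (1 , 12) ∷ (3 , 5) ∷
  (0 , 3) ∷ (5 , 1) ∷ (2 , 4)  ∷ (3 , 4)  ∷ (5 , 6) ∷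
  (0 , 1) ∷ (2 , 3) ∷ (3 , 13) ∷ (2 , 6)  ∷ (10 , 3) ∷ []

third : ℕ → ℚ
third n = + n / 3

-- The factor 10/7 is the reciprocal of `side`.
cellIndex : ℚ → ℤ
cellIndex q = floor (q * (+ 10 / 7))

sampleRe² sampleIm² : Fin 25 → ℚ
sampleRe² i = let (a , b) = lookup samples i in third a * third a - third b * third b
sampleIm² i = let (a , b) = lookup samples i in third a * third b + third a * third b

-- A copy of `InCell` for rationals that avoids the opaque `ι` and `side`, so that `samples-colored`
-- can be decided by evaluation.
InCellℚ : ℤ → ℚ → Set
InCellℚ k q = k / 1 * (+ 7 / 10) ≤ q × q < ℤ.suc k / 1 * (+ 7 / 10)

samples-colored : ∀ i → (InCellℚ (cellIndex (sampleRe² i)) (sampleRe² i) ×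
  InCellℚ (cellIndex (sampleIm² i)) (sampleIm² i)) ×
  cellColor (cellIndex (sampleRe² i)) (cellIndex (sampleIm² i)) ≡ i
samples-colored = from-yes (Finₚ.all? λ i →
  (inCell? (cellIndex (sampleRe² i)) (sampleRe² i) ×-dec inCell? (cellIndex (sampleIm² i)) (sampleIm² i)) ×-dec
  (cellColor (cellIndex (sampleRe² i)) (cellIndex (sampleIm² i)) Finₚ.≟ i))
  where
  inCell? : ∀ k q → Dec (InCellℚ k q)
  inCell? k q = (k / 1 * (+ 7 / 10) ℚₚ.≤? q) ×-dec (q ℚₚ.<? ℤ.suc k / 1 * (+ 7 / 10))

-- Rectangles

grid≡ : ∀ k → k / 1 * (+ 7 / 10) ≡ grid k
grid≡ k = cong₂ _*_ (sym (ι≡/1 k)) (sym side≡7/10)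

InCellℚ⇒InCell : ∀ {k X q} → (∀ n → seq X n ≡ q) → InCellℚ k q → InCell k X
InCellℚ⇒InCell {k} {X} {q} X≡q (k≤q , q<k+1) =
  ≤-eventually {fromℚ (grid k)} {X} (always λ n → subst₂ _≤_ (grid≡ k) (sym (X≡q n)) k≤q) ,
  b - q , gap< q<b , always λ n → subst (λ a → a + (b - q) ≤ b) (sym (X≡q n))
    (ℚₚ.≤-reflexive rearrange)
  where
  b : ℚ
  b = grid (ℤ.suc k)
  q<b : q < b
  q<b = subst (q <_) (grid≡ (ℤ.suc k)) q<k+1
  add-gap : ∀ p → q + (p - q) ≡ p
  add-gap p = solve (p ∷ q ∷ []) ℚ-ring
  rearrange = add-gap b

HasColor-nonempty : ∀ i → Satisfiable (HasColor i)
HasColor-nonempty i =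
  let (hk , hl) , eq = samples-colored i
      k = cellIndex (sampleRe² i)
      l = cellIndex (sampleIm² i)
  in p , k , l ,
    (InCellℚ⇒InCell {k} {Re² p} (λ _ → refl) hk , InCellℚ⇒InCell {l} {Im² p} (λ _ → refl) hl) , eq
  where
  p : ℝ²
  p = fromℚ (third (proj₁ (lookup samples i))) , fromℚ (third (proj₂ (lookup samples i)))

coloring : ExcludedMiddle 0ℓ → Coloring 25
coloring em = record
  { colorClass = HasColor
  ; respects   = HasColor-respects
  ; nonempty   = HasColor-nonempty
  ; disjoint   = λ i≢j {p} (hi , hj) → i≢j (HasColor-unique {p = p} hi hj)
  ; covers     = λ p →
      let k , hk = InCell-exists em (Re² p)
          l , hl = InCell-exists em (Im² p)
      in cellColor k l , k , l , (hk , hl) , refl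
  }

-- Boundaries of the color classes

level-or-above : ExcludedMiddle 0ℓ → ∀ {k X} → InCell k X → Level X (grid k) ⊎ fromℚ (grid k) R.< X
level-or-above em {k} {X} (k≤X , _) with em {fromℚ (grid k) R.< X}
... | yes k<X = inj₂ k<X
... | no  X≤k = inj₁ (≤∧≥⇒Level {X} {grid k} X≤k k≤X)

InCells-interior : ∀ {k l p} → fromℚ (grid k) R.< Re² p → fromℚ (grid l) R.< Im² p →
  InCells k l p → p ∈ Interior (InCells k l)
InCells-interior {k} {l} {p} k<X l<Y ((_ , X<k+1) , (_ , Y<l+1)) =
  let α , 0<α , openX = InCell-open {k} {Re² p} k<X X<k+1
      β , 0<β , openY = InCell-open {l} {Im² p} l<Y Y<l+1
      η , 0<η , η≤α , η≤β = min 0<α 0<β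
      δ , 0<δ , cont  = square-continuous p 0<η
  in fromℚ δ , fromℚ-mono-< 0<δ , λ {q} q∈ →
    let nearX , nearY = cont q (Ball⇒Near² {p} {q} 0<δ q∈)
    in openX (Re² q) (Ev-map (Bd-mono η≤α) nearX) , openY (Im² q) (Ev-map (Bd-mono η≤β) nearY)

-- Upper cell bounds are strict, so a point off the lower grid lines has a ball mapped into its own
-- cell. As the point is in the closure, this ball meets color `i`; hence the whole cell has color
-- `i` and the point would be interior.
boundary⊆onLevels : (em : ExcludedMiddle 0ℓ) → ∀ i → Boundary (HasColor i) ⊆ OnLevels em grid
boundary⊆onLevels em i {p} (closure , ¬interior) =
  locate (level-or-above em {k} {Re² p} hk) (level-or-above em {l} {Im² p} hl)
  where
  k l : ℤ
  k = proj₁ (InCell-exists em (Re² p))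
  l = proj₁ (InCell-exists em (Im² p))
  hk : InCell k (Re² p)
  hk = proj₂ (InCell-exists em (Re² p))
  hl : InCell l (Im² p)
  hl = proj₂ (InCell-exists em (Im² p))
  ¬both-above : fromℚ (grid k) R.< Re² p → fromℚ (grid l) R.< Im² p → ⊥
  ¬both-above k<X l<Y =
    let r , 0<r , ball⊆ = InCells-interior {k} {l} {p} k<X l<Y (hk , hl)
        q , q∈ , q-color = closure r 0<r
        i≡ = HasColor-unique {p = q} (k , l , ball⊆ {q} q∈ , refl) q-color
    in ¬interior (r , 0<r , λ {q} q∈ → k , l , ball⊆ {q} q∈ , i≡)
  locate : Level (Re² p) (grid k) ⊎ fromℚ (grid k) R.< Re² p →
           Level (Im² p) (grid l) ⊎ fromℚ (grid l) R.< Im² p → OnLevels em grid p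
  locate (inj₁ X≈k) _          = k , inj₁ X≈k
  locate (inj₂ _)   (inj₁ Y≈l) = l , inj₂ Y≈l
  locate (inj₂ k<X) (inj₂ l<Y) = contradiction l<Y (¬both-above k<X)

coloring-measurable : (em : ExcludedMiddle 0ℓ) → JordanMeasurable (coloring em)
coloring-measurable em i ε 0<ε =
  let B , ⊆B , ≤ε = onLevels-null em grid ε 0<ε
  in B , (λ {p} p∈ → ⊆B {p} (boundary⊆onLevels em i {p} p∈)) , ≤ε

-- Alternating sums over vertices of one color

five : ℚ
five = + 5 / 1

residue-≡ : ∀ {k l} → residue k ≡ residue l → ∃[ m ] ι k ≡ ι l + ι m * five
residue-≡ {k} {l} eq = a ℤ.- b , trans (trans (expand k) (shift remainder≡))
  (cong (λ d → ι l + d * five) difference)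
  where
  a b : ℤ
  a = k ℤ./ℕ 5
  b = l ℤ./ℕ 5
  expand : ∀ k → ι k ≡ ν (k ℤ.%ℕ 5) + ι (k ℤ./ℕ 5) * five
  expand k = trans (cong ι (ℤ.a≡a%ℕn+[a/ℕn]*n k 5)) (trans (ι-+ (+ (k ℤ.%ℕ 5)) _)
    (cong (λ q → ν (k ℤ.%ℕ 5) + q) (trans (ι-* (k ℤ./ℕ 5) (+ 5))
      (cong (λ q → ι (k ℤ./ℕ 5) * q) (ι≡/1 (+ 5))))))
  remainder≡ : k ℤ.%ℕ 5 ≡ l ℤ.%ℕ 5
  remainder≡ = trans (sym (Finₚ.toℕ-fromℕ< (ℤ.n%ℕd<d k 5)))
    (trans (cong toℕ eq) (Finₚ.toℕ-fromℕ< (ℤ.n%ℕd<d l 5)))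
  difference : ι a - ι b ≡ ι (a ℤ.- b)
  difference = sym (trans (ι-+ a (ℤ.- b)) (cong (λ q → ι a + q) (ι-neg b)))
  move : ∀ r x y f → r + x * f ≡ (r + y * f) + (x - y) * f
  move r x y f = solve (r ∷ x ∷ y ∷ f ∷ []) ℚ-ring
  shift : k ℤ.%ℕ 5 ≡ l ℤ.%ℕ 5 → ν (k ℤ.%ℕ 5) + ι a * five ≡ ι l + (ι a - ι b) * five
  shift r≡ = trans (cong (λ r → ν r + ι a * five) r≡) (trans (move (ν (l ℤ.%ℕ 5)) (ι a) (ι b) five)
    (cong (λ q → q + (ι a - ι b) * five) (sym (expand l))))

grid-suc : ∀ k → grid (ℤ.suc k) ≡ grid k + side
grid-suc k = trans (cong (λ q → q * side) (trans (ι-+ (+ 1) k) (cong (λ q → q + ι k) ι1)))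
  (distribute (ι k) side)
  where
  distribute : ∀ x s → (1ℚ + x) * s ≡ x * s + s
  distribute x s = solve (x ∷ s ∷ []) ℚ-ring

-- Measured from the center of the cell the error is only half a side, and the offset `½ * side`
-- cancels in differences; four such errors make the 2 sides in `spread`.
InCell⇒Bd : ∀ {k X η} → InCell k X → 0ℚ < η →
  Ev (λ n → Bd (seq X n - (grid k + ½ * side)) (½ * side + η))
InCell⇒Bd {k} {X} {η} (k≤X , X<k+1) 0<η = Ev-map
  (λ {n} (k≤ , ≤k+1) → center (seq X n) (grid k) side k≤
    (subst (λ b → seq X n ≤ b + η) (grid-suc k) ≤k+1))
  (≤⇒Ev {fromℚ (grid k)} {X} k≤X 0<η ⊗ᵉ
   ≤⇒Ev {X} {fromℚ (grid (ℤ.suc k))} (<⇒R≤ {X} {fromℚ (grid (ℤ.suc k))} X<k+1) 0<η)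
  where
  center : ∀ a g s → g ≤ a + η → a ≤ g + s + η → Bd (a - (g + ½ * s)) (½ * s + η)
  center a g s l u = ≤-by (gap l) rearrange , ≤-by (gap u) rearrange′
    where
    rearrange : a - (g + ½ * s) ≡ - (½ * s + η) + (a + η - g)
    rearrange = solve (a ∷ g ∷ s ∷ η ∷ []) ℚ-ring
    rearrange′ : ½ * s + η ≡ a - (g + ½ * s) + (g + s + η - a)
    rearrange′ = solve (a ∷ g ∷ s ∷ η ∷ []) ℚ-ring

tolerance : ℚ
tolerance = + 1 / 1000

0<tolerance : 0ℚ < tolerance
0<tolerance = ℚₚ.positive⁻¹ tolerance

alternating : (Fin 4 → ℝ) → ℕ → ℚ
alternating X n = seq (X 0F) n - seq (X 1F) n + (seq (X 2F) n - seq (X 3F) n)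

-- 5 sides, and 2 sides plus 4 tolerances
period spread : ℚ
period = + 7 / 2
spread = + 351 / 250

five*side : five * side ≡ period
five*side = cong (λ s → five * s) side≡7/10

total-spread : ½ * side + tolerance + (½ * side + tolerance) +
  (½ * side + tolerance + (½ * side + tolerance)) ≡ spread
total-spread = cong (λ s → ½ * s + tolerance + (½ * s + tolerance) +
  (½ * s + tolerance + (½ * s + tolerance))) side≡7/10

Bd-difference : ∀ x₀ x₁ g₀ g₁ h d {r} → Bd (x₀ - (g₀ + h)) r → Bd (x₁ - (g₁ + h)) r →
  g₀ ≡ g₁ + d → Bd (x₀ - x₁ - d) (r + r)
Bd-difference x₀ x₁ g₀ g₁ h d h₀ h₁ refl = Bd-by (Bd-+ h₀ (Bd-neg h₁)) rearrange refl
  where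
  rearrange : x₀ - (g₁ + d + h) + - (x₁ - (g₁ + h)) ≡ x₀ - x₁ - d
  rearrange = solve (x₀ ∷ x₁ ∷ g₁ ∷ h ∷ d ∷ []) ℚ-ring

grid-difference : ∀ {k l} → residue k ≡ residue l → ∃[ m ] grid k ≡ grid l + ι m * period
grid-difference {k} {l} eq = m , trans (cong (λ q → q * side) k≡)
  (trans (distribute (ι l) (ι m) five side) (cong (λ q → grid l + ι m * q) five*side))
  where
  m : ℤ
  m = proj₁ (residue-≡ {k} {l} eq)
  k≡ : ι k ≡ ι l + ι m * five
  k≡ = proj₂ (residue-≡ {k} {l} eq)
  distribute : ∀ l m f s → (l + m * f) * s ≡ l * s + m * (f * s)
  distribute l m f s = solve (l ∷ m ∷ f ∷ s ∷ []) ℚ-ring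

difference-near-period : ∀ {X Y k l} → InCell k X → InCell l Y → residue k ≡ residue l →
  ∃[ m ] Ev (λ n → Bd (seq X n - seq Y n - ι m * period)
    (½ * side + tolerance + (½ * side + tolerance)))
difference-near-period {X} {Y} {k} {l} hX hY eq = proj₁ m ,
  Ev-map (λ {n} (hx , hy) →
    Bd-difference (seq X n) (seq Y n) (grid k) (grid l) (½ * side) (ι (proj₁ m) * period) hx hy (proj₂ m))
    (InCell⇒Bd {k} {X} hX 0<tolerance ⊗ᵉ InCell⇒Bd {l} {Y} hY 0<tolerance)
  where
  m : ∃[ m ] grid k ≡ grid l + ι m * period
  m = grid-difference {k} {l} eq

alternating-near-period : ∀ {X : Fin 4 → ℝ} {k : Fin 4 → ℤ} → (∀ j → InCell (k j) (X j)) →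
  (∀ j j′ → residue (k j) ≡ residue (k j′)) →
  ∃[ z ] Ev (λ n → Bd (alternating X n - ι z * period) spread)
alternating-near-period {X} {k} inCell res≡ =
  let a , ha = difference-near-period {X 0F} {X 1F} (inCell 0F) (inCell 1F) (res≡ 0F 1F)
      b , hb = difference-near-period {X 2F} {X 3F} (inCell 2F) (inCell 3F) (res≡ 2F 3F)
  in a ℤ.+ b , Ev-map
    (λ {n} (da , db) → Bd-by (Bd-+ da db)
      (trans (collect (seq (X 0F) n - seq (X 1F) n) (seq (X 2F) n - seq (X 3F) n) (ι a) (ι b) period)
        (cong (λ q → alternating X n - q * period) (sym (ι-+ a b))))
      total-spread)
    (ha ⊗ᵉ hb)
  where
  collect : ∀ u v a b p → u - a * p + (v - b * p) ≡ u + v - (a + b) * p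
  collect u v a b p = solve (u ∷ v ∷ a ∷ b ∷ p ∷ []) ℚ-ring

far-square : ∀ {w z p r} → 0ℚ ≤ p → r ≤ p → 1ℚ ≤ z → - r ≤ w - z * p → (p - r) * (p - r) ≤ w * w
far-square {w} {z} {p} {r} 0≤p r≤p 1≤z l = ≤-by ((d≥0 ⊕ d≥0) ⊗ gap d≤w ⊕ gap d≤w ⊗ gap d≤w) (square (p - r))
  where
  d≥0 : 0ℚ ≤ p - r
  d≥0 = gap r≤p
  rearrange : w ≡ p - r + (w - z * p - - r + (z - 1ℚ) * p)
  rearrange = solve (w ∷ z ∷ p ∷ r ∷ []) ℚ-ring
  d≤w : p - r ≤ w
  d≤w = ≤-by (gap l ⊕ gap 1≤z ⊗ 0≤p) rearrange
  square : ∀ d → w * w ≡ d * d + ((d + d) * (w - d) + (w - d) * (w - d))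
  square d = solve (w ∷ d ∷ []) ℚ-ring

-- Round numbers inside the available gaps: 4.02 ≤ 4.1 < 2.096², where 2.096 is `period - spread`,
-- and 1.404² ≤ 1.98 < 3.98 / 2, where 1.404 is `spread`. The errors 0.02 around 4 come from
-- `diagonal-near-4`.
square-max square-min : ℚ
square-max = + 41 / 10
square-min = + 99 / 50

square-max<far : square-max < (period - spread) * (period - spread)
square-max<far = from-yes (square-max ℚₚ.<? (period - spread) * (period - spread))

near≤square-min : spread * spread ≤ square-min
near≤square-min = from-yes (spread * spread ℚₚ.≤? square-min)

¬far : ∀ {w} n → w * w ≤ square-max → - spread ≤ w - ν (suc n) * period → ⊥
¬far {w} n w²≤ l = ℚₚ.<-irrefl refl (ℚₚ.<-≤-trans square-max<far (ℚₚ.≤-trans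
  (far-square {w} {ν (suc n)} {period} {spread} (ℚₚ.nonNegative⁻¹ period) (from-yes (spread ℚₚ.≤? period))
    (subst (_≤ ν (suc n)) ι1 (ν-mono {1} {suc n} (ℕ.s≤s ℕ.z≤n))) l)
  w²≤))

-- A nonzero multiple of the period would push ∣w∣ to at least `period - spread`, too large for the
-- hypothesis, so `z` is 0 and ∣w∣ is at most `spread`. Negative `z` reduces to positive by
-- replacing `w` with `- w`.
small-square : ∀ {w} z → Bd (w - ι z * period) spread → w * w ≤ square-max → w * w ≤ square-min
small-square {w} (+ zero) bd _ = ℚₚ.≤-trans (proj₂ (Bd-* bd′ bd′)) near≤square-min
  where
  drop-zero : ∀ p → w - 0ℚ * p ≡ w
  drop-zero p = solve (w ∷ p ∷ []) ℚ-ring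
  bd′ : Bd w spread
  bd′ = Bd-by bd (trans (cong (λ q → w - q * period) ι0) (drop-zero period)) refl
small-square {w} +[1+ n ] (l , _) w²≤ = contradiction l (¬far {w} n w²≤)
small-square {w} -[1+ n ] bd w²≤ =
  contradiction (proj₁ bd′) (¬far { - w} n (subst (_≤ square-max) (-² w) w²≤))
  where
  negate : ∀ z p → - (w - - z * p) ≡ - w - z * p
  negate z p = solve (w ∷ z ∷ p ∷ []) ℚ-ring
  bd′ : Bd (- w - ν (suc n) * period) spread
  bd′ = Bd-by (Bd-neg bd) (trans (cong (λ q → - (w - q * period)) (ι-neg (+ suc n)))
    (negate (ν (suc n)) period)) refl

-- The norm of the alternating sum

Bd-*-near-1 : ∀ {a b A B} → Bd (a - 1ℚ) A → Bd (b - 1ℚ) B → Bd (a * b - 1ℚ) (A * B + A + B)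
Bd-*-near-1 {a} {b} ha hb = Bd-by (Bd-+ (Bd-+ (Bd-* ha hb) ha) hb) rearrange refl
  where
  rearrange : (a - 1ℚ) * (b - 1ℚ) + (a - 1ℚ) + (b - 1ℚ) ≡ a * b - 1ℚ
  rearrange = solve (a ∷ b ∷ []) ℚ-ring

four : ℚ
four = 1ℚ + 1ℚ + 1ℚ + 1ℚ

-- Here `a` is a term of the area and `e` a term of u² + v²; both equal 1 only in the limit, so ∣W∣²
-- = 4 (a e)² is only close to 4.
diagonal-near-4 : ∀ {a e} → Bd (a - 1ℚ) tolerance → Bd (e - 1ℚ) tolerance →
  Bd (four * (a * e * (a * e)) - four) (+ 1 / 50)
diagonal-near-4 {a} {e} ha he = Bd-mono bound (Bd-by (Bd-* (Bd-∣∣ four) square) rearrange refl)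
  where
  t : ℚ
  t = tolerance * tolerance + tolerance + tolerance
  product : Bd (a * e - 1ℚ) t
  product = Bd-*-near-1 {a} {e} ha he
  square : Bd (a * e * (a * e) - 1ℚ) (t * t + t + t)
  square = Bd-*-near-1 {a * e} {a * e} product product
  rearrange : four * (a * e * (a * e) - 1ℚ) ≡ four * (a * e * (a * e)) - four
  rearrange = distribute four (a * e * (a * e))
    where
    distribute : ∀ f x → f * (x - 1ℚ) ≡ f * x - f
    distribute f x = solve (f ∷ x ∷ []) ℚ-ring
  bound : ∣ four ∣ * (t * t + t + t) ≤ + 1 / 50
  bound = from-yes (∣ four ∣ * (t * t + t + t) ℚₚ.≤? + 1 / 50)

-- Each square is at most the sum, hence below `square-max`, and `small-square` then lowers both to
-- `square-min`; two of these do not reach 4 - 1/50.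
no-unit-square-sum : ∀ {w v a e} z z′ →
  w * w + v * v ≡ four * (a * e * (a * e)) → Bd (a - 1ℚ) tolerance → Bd (e - 1ℚ) tolerance →
  Bd (w - ι z * period) spread → Bd (v - ι z′ * period) spread → ⊥
no-unit-square-sum {w} {v} {a} {e} z z′ eq ha he hw hv =
  ℚₚ.<-irrefl refl (ℚₚ.<-≤-trans square-min+square-min< (ℚₚ.≤-trans four-≤
    (ℚₚ.+-mono-≤ (small-square {w} z hw w²≤) (small-square {v} z′ hv v²≤))))
  where
  near-4 : Bd (w * w + v * v - four) (+ 1 / 50)
  near-4 = Bd-by (diagonal-near-4 {a} {e} ha he) (cong (λ q → q - four) (sym eq)) refl
  square-min+square-min< : square-min + square-min < four - + 1 / 50
  square-min+square-min< = from-yes (square-min + square-min ℚₚ.<? four - + 1 / 50)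
  from-below : ∀ {s f t} → - t ≤ s - f → f - t ≤ s
  from-below {s} {f} {t} l = ≤-by (gap l) rearrange
    where
    rearrange : s ≡ f - t + (s - f - - t)
    rearrange = solve (s ∷ f ∷ t ∷ []) ℚ-ring
  four-≤ : four - + 1 / 50 ≤ w * w + v * v
  four-≤ = from-below {w * w + v * v} {four} {+ 1 / 50} (proj₁ near-4)
  summand : ∀ {x y f t} → 0ℚ ≤ y → x + y - f ≤ t → x ≤ f + t
  summand {x} {y} {f} {t} 0≤y u = ≤-by (gap u ⊕ 0≤y) rearrange
    where
    rearrange : f + t ≡ x + (t - (x + y - f) + y)
    rearrange = solve (x ∷ y ∷ f ∷ t ∷ []) ℚ-ring
  four+≤ : four + + 1 / 50 ≤ square-max
  four+≤ = from-yes (four + + 1 / 50 ℚₚ.≤? square-max)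
  w²≤ : w * w ≤ square-max
  w²≤ = ℚₚ.≤-trans (summand {w * w} {v * v} {four} {+ 1 / 50} (0≤sq v) (proj₂ near-4)) four+≤
  v²≤ : v * v ≤ square-max
  v²≤ = ℚₚ.≤-trans (summand {v * v} {w * w} {four} {+ 1 / 50} (0≤sq w)
    (subst (λ q → q - four ≤ + 1 / 50) (ℚₚ.+-comm (w * w) (v * v)) (proj₂ near-4))) four+≤

-- For z ↦ z², the alternating sum over the vertices of a rectangle with sides
-- a and b at a right angle is 2 a b, here 2 i width height (u + i v)².
alternating-Re² : ∀ (R : Rectangle) n → let open Rectangle R using (u; v; width; height) in
  alternating (λ j → Re² (vertex R j)) n ≡
  - ((1ℚ + 1ℚ + 1ℚ + 1ℚ) * (seq width n * seq height n * (seq u n * seq v n)))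
alternating-Re² R n = identity (seq (proj₁ corner) n) (seq (proj₂ corner) n)
  (seq u n) (seq v n) (seq width n) (seq height n)
  where
  open Rectangle R using (corner; u; v; width; height)
  -- The products with `0ℚ` are kept so that the left side agrees by computation with the terms of
  -- the vertices.
  identity : ∀ a b u v w h →
    (a + (0ℚ * u - 0ℚ * v)) * (a + (0ℚ * u - 0ℚ * v)) - (b + (0ℚ * v + 0ℚ * u)) * (b + (0ℚ * v + 0ℚ * u)) -
    ((a + (w * u - 0ℚ * v)) * (a + (w * u - 0ℚ * v)) - (b + (w * v + 0ℚ * u)) * (b + (w * v + 0ℚ * u))) +
    ((a + (w * u - h * v)) * (a + (w * u - h * v)) - (b + (w * v + h * u)) * (b + (w * v + h * u)) -
    ((a + (0ℚ * u - h * v)) * (a + (0ℚ * u - h * v)) - (b + (0ℚ * v + h * u)) * (b + (0ℚ * v + h * u)))) ≡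
    - ((1ℚ + 1ℚ + 1ℚ + 1ℚ) * (w * h * (u * v)))
  identity a b u v w h = solve (a ∷ b ∷ u ∷ v ∷ w ∷ h ∷ []) ℚ-ring

alternating-Im² : ∀ (R : Rectangle) n → let open Rectangle R using (u; v; width; height) in
  alternating (λ j → Im² (vertex R j)) n ≡
  (1ℚ + 1ℚ) * (seq width n * seq height n * (seq u n * seq u n - seq v n * seq v n))
alternating-Im² R n = identity (seq (proj₁ corner) n) (seq (proj₂ corner) n)
  (seq u n) (seq v n) (seq width n) (seq height n)
  where
  open Rectangle R using (corner; u; v; width; height)
  identity : ∀ a b u v w h →
    (a + (0ℚ * u - 0ℚ * v)) * (b + (0ℚ * v + 0ℚ * u)) + (a + (0ℚ * u - 0ℚ * v)) * (b + (0ℚ * v + 0ℚ * u)) -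
    ((a + (w * u - 0ℚ * v)) * (b + (w * v + 0ℚ * u)) + (a + (w * u - 0ℚ * v)) * (b + (w * v + 0ℚ * u))) +
    ((a + (w * u - h * v)) * (b + (w * v + h * u)) + (a + (w * u - h * v)) * (b + (w * v + h * u)) -
    ((a + (0ℚ * u - h * v)) * (b + (0ℚ * v + h * u)) + (a + (0ℚ * u - h * v)) * (b + (0ℚ * v + h * u)))) ≡
    (1ℚ + 1ℚ) * (w * h * (u * u - v * v))
  identity a b u v w h = solve (a ∷ b ∷ u ∷ v ∷ w ∷ h ∷ []) ℚ-ring

-- Rests on (2 u v)² + (u² - v²)² = (u² + v²)², the multiplicativity of the norm on (u + i v)².
alternating-norm : ∀ (R : Rectangle) n → let open Rectangle R using (u; v; width; height) in
  alternating (λ j → Re² (vertex R j)) n * alternating (λ j → Re² (vertex R j)) n +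
  alternating (λ j → Im² (vertex R j)) n * alternating (λ j → Im² (vertex R j)) n ≡
  four * (seq width n * seq height n * (seq u n * seq u n + seq v n * seq v n) *
    (seq width n * seq height n * (seq u n * seq u n + seq v n * seq v n)))
alternating-norm R n = trans
  (cong₂ (λ w v → w * w + v * v) (alternating-Re² R n) (alternating-Im² R n))
  (identity (seq u n) (seq v n) (seq width n * seq height n))
  where
  open Rectangle R using (corner; u; v; width; height)
  identity : ∀ u v a →
    - ((1ℚ + 1ℚ + 1ℚ + 1ℚ) * (a * (u * v))) * - ((1ℚ + 1ℚ + 1ℚ + 1ℚ) * (a * (u * v))) +
    (1ℚ + 1ℚ) * (a * (u * u - v * v)) * ((1ℚ + 1ℚ) * (a * (u * u - v * v))) ≡
    (1ℚ + 1ℚ + 1ℚ + 1ℚ) * (a * (u * u + v * v) * (a * (u * u + v * v)))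
  identity u v a = solve (u ∷ v ∷ a ∷ []) ℚ-ring

no-monochromatic-rectangle : ∀ i (R : Rectangle) → area R ≈ 1ℝ → ¬ ContainsVertices (HasColor i) R
no-monochromatic-rectangle i R area≈1 color =
  let z  , hw = alternating-near-period {λ j → Re² (vertex R j)} {k}
        (λ j → proj₁ (cells j)) (λ j j′ → proj₁ (same j j′))
      z′ , hv = alternating-near-period {λ j → Im² (vertex R j)} {l}
        (λ j → proj₂ (cells j)) (λ j j′ → proj₂ (same j j′))
      -- One index at which all the estimates hold suffices, since they already contradict each
      -- other as rational inequalities.
      n , nearW , nearV , nearArea , nearUnit = sample (hw ⊗ᵉ hv ⊗ᵉ
        ≈⇒Bd {area R} {1ℝ} area≈1 0<tolerance ⊗ᵉ
        ≈⇒Bd {u R.* u R.+ v R.* v} {1ℝ} unit 0<tolerance)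
  in no-unit-square-sum {W n} {V n} {seq (area R) n} {seq (u R.* u R.+ v R.* v) n} z z′
    (alternating-norm R n) nearArea nearUnit nearW nearV
  where
  open Rectangle R using (u; v; unit)
  W V : ℕ → ℚ
  W = alternating (λ j → Re² (vertex R j))
  V = alternating (λ j → Im² (vertex R j))
  k l : Fin 4 → ℤ
  k j = proj₁ (color j)
  l j = proj₁ (proj₂ (color j))
  cells : ∀ j → InCells (k j) (l j) (vertex R j)
  cells j = proj₁ (proj₂ (proj₂ (color j)))
  colored : ∀ j → cellColor (k j) (l j) ≡ i
  colored j = proj₂ (proj₂ (proj₂ (color j)))
  same : ∀ j j′ → residue (k j) ≡ residue (k j′) × residue (l j) ≡ residue (l j′)
  same j j′ = Finₚ.combine-injective (residue (k j)) (residue (l j)) (residue (k j′)) (residue (l j′))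
    (trans (colored j) (sym (colored j′)))

theorem3 : ExcludedMiddle 0ℓ →
    Σ[ c ∈ Coloring 25 ]
    (JordanMeasurable c ×
    (∀ i (R : Rectangle) → area R ≈ 1ℝ → ¬ ContainsVertices (colorClass c i) R))
theorem3 em = coloring em , coloring-measurable em , no-monochromatic-rectangle
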